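{- Let $(X,G)$ be an association scheme. Assume there exist $c,k,\ell\in\mathbb{N}$ and real numbers $0<\delta_1,\delta'_1,\delta'_2\leq 1$ with $1<\ell<(\delta_1^2/\delta'_1)\cdot k$ such that for all $g\in G$ with $g\neq 1$, \[\delta_1 k\leq n_g\leq \delta'_1 k \quad\text{and}\quad c(g)\leq \delta'_2 c.\] If $|G|\geq 2(\delta'_1/\delta_1)^3\delta'_2\cdot\frac{c}{\ell-1}+2$, then there exist relations $u,v,w,w'\in G\setminus\{1\}$ with $u\neq v$ and $w\neq w'$ such that $0<c^{w}_{u^{*}v}\leq c^{w'}_{u^{*}v}<\ell$.
   Context: An association scheme is a pair $(X,G)$ where $X$ is a finite set and $G$ is a partition of $X\times X$ such that (1) $G$ contains the identity relation $1:=\{(x,x)\mid x\in X\}$; (2) if $g\in G$ then $g^{*}:=\{(y,x)\mid (x,y)\in g\}\in G$; (3) for all $f,g,h\in G$ there is an integer $c^{h}_{fg}$ (intersection number) such that for all $(\alpha,\beta)\in h$, $c^{h}_{fg}=\#\{\gamma\in X\mid (\alpha,\gamma)\in f,\ (\gamma,\beta)\in g\}$. Elements of $G$ are called relations. For $g\in G$, its valency is $n_g:=c^{1}_{gg^{*}}$ and its indistinguishing number is $c(g):=\sum_{v\in G}c^{g}_{vv^{*}}$. -}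

module Defs where

open import Data.Fin.Base using (Fin)
open import Data.Fin.Properties using () renaming (_≟_ to _≟ᶠ_)
open import Data.Integer.Base using (+_)
open import Data.List.Base using (length; filter; allFin)
open import Data.Nat.Base as ℕ using (ℕ; zero; suc; _∸_; s≤s; z≤n)
import Data.Nat.Properties as ℕₚ
open import Data.Product using (∃; ∃₂; ∃!; _×_; _,_)
open import Data.Rational.Base as ℚ
  using (ℚ; 0ℚ; 1ℚ; ½; _/_; 1/_; ∣_∣; _+_; _*_; _-_; _<_; _≤_;
         ≢-nonZero; >-nonZero; positive; nonNegative)
import Data.Rational.Properties as ℚₚ
open import Data.Rational.Solver using (module +-*-Solver)
open import Function.Bundles using (_⇔_)
open import Level using (0ℓ)
open import Relation.Binary.PropositionalEquality
open import Relation.Nullary using (yes; no; contradiction; _×-dec_)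
open import Relation.Nullary.Decidable using (map′)
open import Relation.Unary using (Pred; Decidable)
open import Algebra.Properties.CommutativeMonoid.Sum ℕₚ.+-0-commutativeMonoid
  using (sum)

------------------------------------------------------------------------
-- Real numbers, as Cauchy sequences of rationals. Two sequences denote
-- the same real when their difference tends to 0; all operations and
-- relations below respect this equivalence.

IsCauchy : (ℕ → ℚ) → Set
IsCauchy s = ∀ ε → 0ℚ < ε →
  ∃ λ N → ∀ m n → N ℕ.≤ m → N ℕ.≤ n → ∣ s m - s n ∣ < ε

record ℝ : Set where
  constructor mkℝ
  field
    seq    : ℕ → ℚ
    cauchy : IsCauchy seq

open ℝ public

infix  4 _<ℝ_ _≤ℝ_
infixl 6 _+ℝ_
infixl 7 _*ℝ_ _/ℝ_
infixr 8 _^ℝ_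

record _<ℝ_ (x y : ℝ) : Set where
  constructor mk<
  field
    gap   : ℚ
    0<gap : 0ℚ < gap
    from  : ℕ
    bound : ∀ n → from ℕ.≤ n → seq x n + gap ≤ seq y n

_≤ℝ_ : ℝ → ℝ → Set
x ≤ℝ y = ∀ ε → 0ℚ < ε → ∃ λ N → ∀ n → N ℕ.≤ n → seq x n ≤ seq y n + ε

private
  open +-*-Solver using (solve; _:+_; _:*_; _:-_; _:=_)
  open ℚₚ.≤-Reasoning

  halves : ∀ p → p * ½ + p * ½ ≡ p
  halves p = trans (sym (ℚₚ.*-distribˡ-+ p ½ ½)) (ℚₚ.*-identityʳ p)

  0<* : ∀ {p q} → 0ℚ < p → 0ℚ < q → 0ℚ < p * q
  0<* {p} {q} 0<p 0<q =
    ℚₚ.positive⁻¹ _ {{ℚₚ.pos*pos⇒pos p {{positive 0<p}} q {{positive 0<q}}}}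

  0<1/ : ∀ p (0<p : 0ℚ < p) → 0ℚ < (1/ p) {{>-nonZero 0<p}}
  0<1/ p 0<p = ℚₚ.positive⁻¹ _ {{ℚₚ.1/pos⇒pos p {{positive 0<p}}}}

  0<1 : 0ℚ < 1ℚ
  0<1 = ℚₚ.positive⁻¹ 1ℚ

  0≤∣_∣ : ∀ p → 0ℚ ≤ ∣ p ∣
  0≤∣ p ∣ = ℚₚ.nonNegative⁻¹ _ {{ℚₚ.∣-∣-nonNeg p}}

  *-mono-≤ : ∀ {p q r s} → 0ℚ ≤ p → 0ℚ ≤ s → p ≤ q → r ≤ s → p * r ≤ q * s
  *-mono-≤ {p} {q} {r} {s} 0≤p 0≤s p≤q r≤s = begin
    p * r ≤⟨ ℚₚ.*-monoˡ-≤-nonNeg p {{nonNegative 0≤p}} r≤s ⟩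
    p * s ≤⟨ ℚₚ.*-monoʳ-≤-nonNeg s {{nonNegative 0≤s}} p≤q ⟩
    q * s ∎

  const-cauchy : ∀ q → IsCauchy (λ _ → q)
  const-cauchy q ε 0<ε =
    0 , λ _ _ _ _ → subst (λ z → ∣ z ∣ < ε) (sym (ℚₚ.+-inverseʳ q)) 0<ε

  +-cauchy : ∀ {s t} → IsCauchy s → IsCauchy t → IsCauchy (λ n → s n + t n)
  +-cauchy {s} {t} cs ct ε 0<ε
    with cs (ε * ½) (0<* 0<ε (ℚₚ.positive⁻¹ ½))
       | ct (ε * ½) (0<* 0<ε (ℚₚ.positive⁻¹ ½))
  ... | N₁ , h₁ | N₂ , h₂ = N₁ ℕ.⊔ N₂ , λ m n N≤m N≤n → begin-strict
    ∣ s m + t m - (s n + t n) ∣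
      ≡⟨ cong ∣_∣ (solve 4 (λ a b c d →
           a :+ b :- (c :+ d) := (a :- c) :+ (b :- d)) refl (s m) (t m) (s n) (t n)) ⟩
    ∣ (s m - s n) + (t m - t n) ∣
      ≤⟨ ℚₚ.∣p+q∣≤∣p∣+∣q∣ (s m - s n) (t m - t n) ⟩
    ∣ s m - s n ∣ + ∣ t m - t n ∣
      <⟨ ℚₚ.+-mono-<
           (h₁ m n (ℕₚ.m⊔n≤o⇒m≤o N₁ N₂ N≤m) (ℕₚ.m⊔n≤o⇒m≤o N₁ N₂ N≤n))
           (h₂ m n (ℕₚ.m⊔n≤o⇒n≤o N₁ N₂ N≤m) (ℕₚ.m⊔n≤o⇒n≤o N₁ N₂ N≤n)) ⟩
    ε * ½ + ε * ½
      ≡⟨ halves ε ⟩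
    ε ∎

  eventually-bounded : ∀ {s} → IsCauchy s →
    ∃₂ λ B N → 0ℚ < B × (∀ n → N ℕ.≤ n → ∣ s n ∣ ≤ B)
  eventually-bounded {s} cs with cs 1ℚ 0<1
  ... | N , h = 1ℚ + ∣ s N ∣ , N ,
      ℚₚ.+-mono-<-≤ 0<1 0≤∣ s N ∣ , λ n N≤n → begin
    ∣ s n ∣                   ≡⟨ cong ∣_∣ (solve 2 (λ a b → a := (a :- b) :+ b) refl (s n) (s N)) ⟩
    ∣ (s n - s N) + s N ∣     ≤⟨ ℚₚ.∣p+q∣≤∣p∣+∣q∣ (s n - s N) (s N) ⟩
    ∣ s n - s N ∣ + ∣ s N ∣   ≤⟨ ℚₚ.+-monoˡ-≤ ∣ s N ∣ (ℚₚ.<⇒≤ (h n N N≤n ℕₚ.≤-refl)) ⟩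
    1ℚ + ∣ s N ∣              ∎

  cancel : ∀ B ε → (0<B : 0ℚ < B) → B * (ε * (1/ B) {{>-nonZero 0<B}}) ≡ ε
  cancel B ε 0<B = let instance _ = >-nonZero 0<B in begin-equality
    B * (ε * 1/ B) ≡⟨ solve 3 (λ b e i → b :* (e :* i) := e :* (b :* i)) refl B ε (1/ B) ⟩
    ε * (B * 1/ B) ≡⟨ cong (ε *_) (ℚₚ.*-inverseʳ B) ⟩
    ε * 1ℚ         ≡⟨ ℚₚ.*-identityʳ ε ⟩
    ε              ∎

  product-split : ∀ a b c d → a * b - c * d ≡ a * (b - d) + (a - c) * d
  product-split = solve 4 (λ a b c d →
    a :* b :- c :* d := a :* (b :- d) :+ (a :- c) :* d) refl

  product-close : ∀ {A B η} a b c d → 0ℚ ≤ B → 0ℚ ≤ η → ∣ a ∣ ≤ A → ∣ d ∣ ≤ B →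
    ∣ a - c ∣ ≤ η → ∣ b - d ∣ ≤ η → ∣ a * b - c * d ∣ ≤ (A + B) * η
  product-close {A} {B} {η} a b c d 0≤B 0≤η a≤A d≤B ac bd = begin
    ∣ a * b - c * d ∣                     ≡⟨ cong ∣_∣ (product-split a b c d) ⟩
    ∣ a * (b - d) + (a - c) * d ∣         ≤⟨ ℚₚ.∣p+q∣≤∣p∣+∣q∣ (a * (b - d)) ((a - c) * d) ⟩
    ∣ a * (b - d) ∣ + ∣ (a - c) * d ∣     ≡⟨ cong₂ _+_ (ℚₚ.∣p*q∣≡∣p∣*∣q∣ a (b - d)) (ℚₚ.∣p*q∣≡∣p∣*∣q∣ (a - c) d) ⟩
    ∣ a ∣ * ∣ b - d ∣ + ∣ a - c ∣ * ∣ d ∣ ≤⟨ ℚₚ.+-mono-≤ (*-mono-≤ 0≤∣ a ∣ 0≤η a≤A bd) (*-mono-≤ 0≤∣ a - c ∣ 0≤B ac d≤B) ⟩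
    A * η + η * B                         ≡⟨ cong (λ z → A * η + z) (ℚₚ.*-comm η B) ⟩
    A * η + B * η                         ≡⟨ ℚₚ.*-distribʳ-+ η A B ⟨
    (A + B) * η                           ∎

  ½< : ∀ ε → 0ℚ < ε → ε * ½ < ε
  ½< ε 0<ε = begin-strict
    ε * ½         ≡⟨ ℚₚ.+-identityʳ (ε * ½) ⟨
    ε * ½ + 0ℚ    <⟨ ℚₚ.+-monoʳ-< (ε * ½) (0<* 0<ε (ℚₚ.positive⁻¹ ½)) ⟩
    ε * ½ + ε * ½ ≡⟨ halves ε ⟩
    ε             ∎

  shrink : ∀ ε C → 0ℚ < ε → 0ℚ < C → ∃ λ η → 0ℚ < η × C * η < ε
  shrink ε C 0<ε 0<C =
      ε * ½ * (1/ C) {{>-nonZero 0<C}}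
    , 0<* (0<* 0<ε (ℚₚ.positive⁻¹ ½)) (0<1/ C 0<C)
    , subst (_< ε) (sym (cancel C (ε * ½) 0<C)) (½< ε 0<ε)

  *-cauchy : ∀ {s t} → IsCauchy s → IsCauchy t → IsCauchy (λ n → s n * t n)
  *-cauchy {s} {t} cs ct ε 0<ε =
    let A , Nₐ , 0<A , s≤A = eventually-bounded cs
        B , Nᵦ , 0<B , t≤B = eventually-bounded ct
        η , 0<η , small    = shrink ε (A + B) 0<ε (ℚₚ.+-mono-< 0<A 0<B)
        N₁ , h₁            = cs η 0<η
        N₂ , h₂            = ct η 0<η
        M                  = Nₐ ℕ.⊔ Nᵦ
        N                  = N₁ ℕ.⊔ N₂
        M≤ : ∀ {i} → M ℕ.⊔ N ℕ.≤ i → M ℕ.≤ i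
        M≤ = ℕₚ.m⊔n≤o⇒m≤o M N
        N≤ : ∀ {i} → M ℕ.⊔ N ℕ.≤ i → N ℕ.≤ i
        N≤ = ℕₚ.m⊔n≤o⇒n≤o M N
    in M ℕ.⊔ N , λ m n ≤m ≤n → ℚₚ.≤-<-trans
      (product-close (s m) (t m) (s n) (t n) (ℚₚ.<⇒≤ 0<B) (ℚₚ.<⇒≤ 0<η)
        (s≤A m (ℕₚ.m⊔n≤o⇒m≤o Nₐ Nᵦ (M≤ ≤m)))
        (t≤B n (ℕₚ.m⊔n≤o⇒n≤o Nₐ Nᵦ (M≤ ≤n)))
        (ℚₚ.<⇒≤ (h₁ m n (ℕₚ.m⊔n≤o⇒m≤o N₁ N₂ (N≤ ≤m)) (ℕₚ.m⊔n≤o⇒m≤o N₁ N₂ (N≤ ≤n))))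
        (ℚₚ.<⇒≤ (h₂ m n (ℕₚ.m⊔n≤o⇒n≤o N₁ N₂ (N≤ ≤m)) (ℕₚ.m⊔n≤o⇒n≤o N₁ N₂ (N≤ ≤n)))))
      small

fromℚ : ℚ → ℝ
fromℚ q = mkℝ (λ _ → q) (const-cauchy q)

fromℕ : ℕ → ℝ
fromℕ n = fromℚ (+ n / 1)

0ℝ 1ℝ : ℝ
0ℝ = fromℕ 0
1ℝ = fromℕ 1

_+ℝ_ : ℝ → ℝ → ℝ
x +ℝ y = mkℝ (λ n → seq x n + seq y n) (+-cauchy {seq x} {seq y} (cauchy x) (cauchy y))

_*ℝ_ : ℝ → ℝ → ℝ
x *ℝ y = mkℝ (λ n → seq x n * seq y n) (*-cauchy {seq x} {seq y} (cauchy x) (cauchy y))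

_^ℝ_ : ℝ → ℕ → ℝ
x ^ℝ zero  = 1ℝ
x ^ℝ suc n = x *ℝ x ^ℝ n

-- The value at 0 is irrelevant: the terms of a sequence denoting a
-- positive real are eventually bounded away from 0.
recipℚ : ℚ → ℚ
recipℚ q with q ℚₚ.≟ 0ℚ
... | yes _   = 0ℚ
... | no  q≢0 = (1/ q) {{≢-nonZero q≢0}}

recipℚ-inverse : ∀ {q} → 0ℚ < q → recipℚ q * q ≡ 1ℚ
recipℚ-inverse {q} 0<q with q ℚₚ.≟ 0ℚ
... | yes q≡0 = contradiction (sym q≡0) (ℚₚ.<⇒≢ 0<q)
... | no  q≢0 = ℚₚ.*-inverseˡ q {{≢-nonZero q≢0}}

private
  recipℚ-pos : ∀ {q} → 0ℚ < q → 0ℚ < recipℚ q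
  recipℚ-pos {q} 0<q with q ℚₚ.≟ 0ℚ
  ... | yes q≡0 = contradiction (sym q≡0) (ℚₚ.<⇒≢ 0<q)
  ... | no  q≢0 = ℚₚ.positive⁻¹ _ {{ℚₚ.1/pos⇒pos q {{positive 0<q}}}}

  recipℚ-anti : ∀ {p q} → 0ℚ < p → p ≤ q → recipℚ q ≤ recipℚ p
  recipℚ-anti {p} {q} 0<p p≤q = begin
    recipℚ q                    ≡⟨ ℚₚ.*-identityʳ _ ⟨
    recipℚ q * 1ℚ               ≡⟨ cong (recipℚ q *_) (recipℚ-inverse 0<p) ⟨
    recipℚ q * (recipℚ p * p)   ≤⟨ *-mono-≤ (ℚₚ.<⇒≤ (recipℚ-pos 0<q))
                                     (ℚₚ.<⇒≤ (0<* (recipℚ-pos 0<p) 0<q)) ℚₚ.≤-refl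
                                     (*-mono-≤ (ℚₚ.<⇒≤ (recipℚ-pos 0<p)) (ℚₚ.<⇒≤ 0<q) ℚₚ.≤-refl p≤q) ⟩
    recipℚ q * (recipℚ p * q)   ≡⟨ solve 3 (λ a b c → a :* (b :* c) := b :* (a :* c)) refl
                                     (recipℚ q) (recipℚ p) q ⟩
    recipℚ p * (recipℚ q * q)   ≡⟨ cong (recipℚ p *_) (recipℚ-inverse 0<q) ⟩
    recipℚ p * 1ℚ               ≡⟨ ℚₚ.*-identityʳ _ ⟩
    recipℚ p                    ∎
    where
    0<q : 0ℚ < q
    0<q = ℚₚ.<-≤-trans 0<p p≤q

  recip-split : ∀ a b a′ b′ →
    a′ * (b′ * b) - b′ * (a′ * a) ≡ (a′ * b′) * (b - a)
  recip-split = solve 4 (λ a b a′ b′ →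
    a′ :* (b′ :* b) :- b′ :* (a′ :* a) := (a′ :* b′) :* (b :- a)) refl

  regroup : ∀ i ε e → (i * i) * (ε * (e * e)) ≡ ε * ((i * e) * (i * e))
  regroup = solve 3 (λ i ε e →
    (i :* i) :* (ε :* (e :* e)) := ε :* ((i :* e) :* (i :* e))) refl

  recip-close : ∀ {e ε} a b → 0ℚ < e → e ≤ a → e ≤ b →
    ∣ b - a ∣ < ε * (e * e) → ∣ recipℚ a - recipℚ b ∣ < ε
  recip-close {e} {ε} a b 0<e e≤a e≤b close = begin-strict
    ∣ a′ - b′ ∣                       ≡⟨ cong ∣_∣ (cong₂ _-_ (ℚₚ.*-identityʳ a′) (ℚₚ.*-identityʳ b′)) ⟨
    ∣ a′ * 1ℚ - b′ * 1ℚ ∣             ≡⟨ cong ∣_∣ (cong₂ (λ u v → a′ * u - b′ * v) (recipℚ-inverse 0<b) (recipℚ-inverse 0<a)) ⟨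
    ∣ a′ * (b′ * b) - b′ * (a′ * a) ∣ ≡⟨ cong ∣_∣ (recip-split a b a′ b′) ⟩
    ∣ (a′ * b′) * (b - a) ∣           ≡⟨ ℚₚ.∣p*q∣≡∣p∣*∣q∣ (a′ * b′) (b - a) ⟩
    ∣ a′ * b′ ∣ * ∣ b - a ∣           ≡⟨ cong (_* ∣ b - a ∣) (ℚₚ.0≤p⇒∣p∣≡p (ℚₚ.<⇒≤ (0<* (recipℚ-pos 0<a) (recipℚ-pos 0<b)))) ⟩
    (a′ * b′) * ∣ b - a ∣             ≤⟨ ℚₚ.*-monoʳ-≤-nonNeg ∣ b - a ∣ {{ℚₚ.∣-∣-nonNeg (b - a)}}
                                           (*-mono-≤ (ℚₚ.<⇒≤ (recipℚ-pos 0<a)) (ℚₚ.<⇒≤ 0<i)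
                                             (recipℚ-anti 0<e e≤a) (recipℚ-anti 0<e e≤b)) ⟩
    (i * i) * ∣ b - a ∣               <⟨ ℚₚ.*-monoʳ-<-pos (i * i) {{positive (0<* 0<i 0<i)}} close ⟩
    (i * i) * (ε * (e * e))           ≡⟨ regroup i ε e ⟩
    ε * ((i * e) * (i * e))           ≡⟨ cong (λ z → ε * (z * z)) (recipℚ-inverse 0<e) ⟩
    ε * (1ℚ * 1ℚ)                     ≡⟨ ℚₚ.*-identityʳ ε ⟩
    ε                                 ∎
    where
    i a′ b′ : ℚ
    i = recipℚ e
    a′ = recipℚ a
    b′ = recipℚ b
    0<a : 0ℚ < a
    0<a = ℚₚ.<-≤-trans 0<e e≤a
    0<b : 0ℚ < b
    0<b = ℚₚ.<-≤-trans 0<e e≤b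
    0<i : 0ℚ < i
    0<i = recipℚ-pos 0<e

  recip-cauchy : ∀ y → 0ℝ <ℝ y → IsCauchy (λ n → recipℚ (seq y n))
  recip-cauchy y (mk< e 0<e M e≤y) ε 0<ε =
    let N , h = cauchy y (ε * (e * e)) (0<* 0<ε (0<* 0<e 0<e))
        away : ∀ n → M ℕ.⊔ N ℕ.≤ n → e ≤ seq y n
        away n ≤n = subst (_≤ seq y n) (ℚₚ.+-identityˡ e) (e≤y n (ℕₚ.m⊔n≤o⇒m≤o M N ≤n))
    in M ℕ.⊔ N , λ m n ≤m ≤n →
      recip-close (seq y m) (seq y n) 0<e (away m ≤m) (away n ≤n)
        (h n m (ℕₚ.m⊔n≤o⇒n≤o M N ≤n) (ℕₚ.m⊔n≤o⇒n≤o M N ≤m))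

_/ℝ_ : ℝ → (y : ℝ) → ⦃ 0ℝ <ℝ y ⦄ → ℝ
_/ℝ_ x y ⦃ 0<y ⦄ = x *ℝ mkℝ (λ n → recipℚ (seq y n)) (recip-cauchy y 0<y)

0<∸1 : ∀ {n} → 1 ℕ.< n → 0ℝ <ℝ fromℕ (n ∸ 1)
0<∸1 {suc (suc n)} (s≤s (s≤s _)) = mk< q
  (ℚₚ.positive⁻¹ q {{ℚₚ.normalize-pos (suc n) 1}})
  0 (λ _ _ → ℚₚ.≤-reflexive (ℚₚ.+-identityˡ q))
  where
  q : ℚ
  q = + suc n / 1

------------------------------------------------------------------------
-- Association schemes

#_ : ∀ {n} {P : Pred (Fin n) 0ℓ} → Decidable P → ℕ
#_ {n} P? = length (filter P? (allFin n))

∃!⇒dec : ∀ {n} {P : Pred (Fin n) 0ℓ} → ∃! _≡_ P → Decidable P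
∃!⇒dec {P = P} (i , Pi , unique) j = map′ (λ i≡j → subst P i≡j Pi) unique (i ≟ᶠ j)

-- X is a set of ∣X∣ points and G a set of ∣G∣ subsets of X × X, indexed
-- by Fin ∣G∣. The fields nonempty and partition together force distinct
-- indices to name distinct (indeed disjoint) relations, so equality in G
-- is equality of relations, and 𝟏, g *ᴳ, c^ h [ f , g ] are unique.
-- The latter is the intersection number with superscript h, subscripts f, g.
record AssociationScheme : Set₁ where
  infix 4 ⟨_,_⟩∈_
  infix 9 _*ᴳ
  field
    ∣X∣ ∣G∣ : ℕ

  X : Set
  X = Fin ∣X∣

  G : Set
  G = Fin ∣G∣

  field
    ⟨_,_⟩∈_   : X → X → G → Set
    nonempty  : ∀ g → ∃₂ λ α β → ⟨ α , β ⟩∈ g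
    partition : ∀ α β → ∃! _≡_ λ g → ⟨ α , β ⟩∈ g

  ⟨_,_⟩∈?_ : ∀ α β → Decidable (⟨ α , β ⟩∈_)
  ⟨ α , β ⟩∈? g = ∃!⇒dec (partition α β) g

  field
    𝟏       : G
    𝟏-spec  : ∀ α β → ⟨ α , β ⟩∈ 𝟏 ⇔ α ≡ β
    _*ᴳ     : G → G
    *-spec  : ∀ g α β → ⟨ β , α ⟩∈ (g *ᴳ) ⇔ ⟨ α , β ⟩∈ g
    c^_[_,_] : G → G → G → ℕ
    c-spec  : ∀ f g h α β → ⟨ α , β ⟩∈ h →
              c^ h [ f , g ] ≡ # (λ γ → ⟨ α , γ ⟩∈? f ×-dec ⟨ γ , β ⟩∈? g)

  valency : G → ℕ
  valency g = c^ 𝟏 [ g , g *ᴳ ]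

  indistinguishing : G → ℕ
  indistinguishing g = sum λ (v : G) → c^ g [ v , v *ᴳ ]

{-# OPTIONS --safe #-}
module Submission where

-- Suppose no such u, v, w, w′ exist, and choose m ≠ 1 of minimal valency n.
-- Fix a point α, and for v ∈ G let a_v(β) be the number of γ with (α,γ) ∈ m
-- and (γ,β) ∈ v; this is c^w_{u*v} for u = m* and (α,β) ∈ w. We bound the sum
-- of a_v(β)² over v and β from both sides.
--
-- Above: the sum counts the triples (γ,γ′,β) with γ, γ′ ∈ αm and
-- r(γ,β) = r(γ′,β), where r(x,y) is the relation containing (x,y); a pair
-- γ ≠ γ′ lies in c(r(γ,γ′)) of them.
--
-- Below: for v ∉ {1, u} at most one relation w ∋ (α,β) has 0 < a_v(β) < ℓ.
-- Outside w, a² ≥ ℓ a; inside w, 4a² + ℓ² ≥ 4ℓ a by AM-GM, and the loss is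
-- absorbed because ℓ n_w ≤ n n_v.
--
-- The real hypotheses enter only through three inequalities between naturals:
-- |G| ≥ 2, ℓ n_w ≤ n_u n_v and 2 c(h) ≤ (|G| − 2)(ℓ − 1) for u, v, w, h ≠ 1
-- (the last one because δ₁ ≤ δ₁′).

open import Defs
open import Data.Bool.Base using (true; false; if_then_else_)
open import Data.Fin.Base using (Fin; zero; suc)
open import Data.Fin.Properties using (any?) renaming (_≟_ to _≟ᶠ_)
import Data.Integer as ℤ
import Data.Integer.Properties as ℤ
open import Data.List.Base using (length; filter; allFin; tabulate)
open import Data.List.Extrema.Nat using (argmin; f[argmin]≤f[xs]; argmin-all)
open import Data.List.Membership.Propositional.Properties using (∈-allFin; ∈-filter⁺)
import Data.List.Relation.Unary.All as All
open import Data.List.Relation.Unary.All.Properties using (all-filter)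
open import Data.Nat
  using (ℕ; zero; suc; _+_; _*_; _∸_; pred; _≤_; _<_; z≤n; s≤s; z<s; _≤?_; _<?_; >-nonZero)
import Data.Nat as ℕ
open import Data.Nat.Properties
import Data.Nat.Properties as ℕ
open import Algebra.Properties.Semiring.Sum +-*-semiring
open import Data.Nat.Tactic.RingSolver using (solve-∀)
open import Data.Product using (∃; _×_; _,_; proj₁; proj₂)
open import Data.Rational using (ℚ; 0ℚ; 1ℚ)
import Data.Rational as ℚ
import Data.Rational.Properties as ℚ
open import Data.Rational.Solver using (module +-*-Solver)
import Data.Rational.Unnormalised as ℚᵘ
import Data.Rational.Unnormalised.Properties as ℚᵘ
open import Data.Sum.Base using (inj₁; inj₂)
open import Function.Base using (_∘_; id; case_of_)
open import Function.Bundles using (module Equivalence)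
open import Level using (0ℓ)
open import Relation.Binary.Bundles using (Preorder)
open import Relation.Binary.PropositionalEquality
  using (_≡_; _≢_; refl; sym; trans; cong; cong₂; subst; subst₂; isEquivalence; module ≡-Reasoning)
import Relation.Binary.Reasoning.Preorder
open import Relation.Nullary using (Dec; yes; no; does; ¬_; ¬?; _×-dec_; contradiction)
open import Relation.Nullary.Decidable using (decidable-stable)
open import Relation.Unary using (Pred; Decidable)

open Equivalence using (to; from)

-- Inequalities between real numbers

private
  ι : ℕ → ℚ
  ι n = ℤ.+ n ℚ./ 1

  -- `ι` normalises its fraction; among the unnormalised rationals the denominator is literally 1,
  -- so arithmetic of `ι` reduces to arithmetic of integers.
  ιᵘ : ∀ n → ℚ.toℚᵘ (ι n) ℚᵘ.≃ ℚᵘ.mkℚᵘ (ℤ.+ n) 0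
  ιᵘ n = ℚ.toℚᵘ-fromℚᵘ (ℚᵘ.mkℚᵘ (ℤ.+ n) 0)

ι-+ : ∀ m n → ι (m ℕ.+ n) ≡ ι m ℚ.+ ι n
ι-+ m n = ℚ.toℚᵘ-injective (begin
  ℚ.toℚᵘ (ι (m ℕ.+ n))                         ≈⟨ ιᵘ (m ℕ.+ n) ⟩
  ℚᵘ.mkℚᵘ (ℤ.+ (m ℕ.+ n)) 0
    -- Unnormalised addition cross-multiplies by the denominators, which leaves factors 1 to remove.
    ≡⟨ cong₂ (λ x y → ℚᵘ.mkℚᵘ (x ℤ.+ y) 0) (ℤ.*-identityʳ (ℤ.+ m)) (ℤ.*-identityʳ (ℤ.+ n)) ⟨
  ℚᵘ.mkℚᵘ (ℤ.+ m) 0 ℚᵘ.+ ℚᵘ.mkℚᵘ (ℤ.+ n) 0     ≈⟨ ℚᵘ.+-cong (ιᵘ m) (ιᵘ n) ⟨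
  ℚ.toℚᵘ (ι m) ℚᵘ.+ ℚ.toℚᵘ (ι n)               ≈⟨ ℚ.toℚᵘ-homo-+ (ι m) (ι n) ⟨
  ℚ.toℚᵘ (ι m ℚ.+ ι n)                         ∎)
  where open import Relation.Binary.Reasoning.Setoid ℚᵘ.≃-setoid

ι-* : ∀ m n → ι (m ℕ.* n) ≡ ι m ℚ.* ι n
ι-* m n = ℚ.toℚᵘ-injective (begin
  ℚ.toℚᵘ (ι (m ℕ.* n))                         ≈⟨ ιᵘ (m ℕ.* n) ⟩
  ℚᵘ.mkℚᵘ (ℤ.+ (m ℕ.* n)) 0                    ≡⟨ cong (λ x → ℚᵘ.mkℚᵘ x 0) (ℤ.pos-* m n) ⟩
  ℚᵘ.mkℚᵘ (ℤ.+ m) 0 ℚᵘ.* ℚᵘ.mkℚᵘ (ℤ.+ n) 0     ≈⟨ ℚᵘ.*-cong (ιᵘ m) (ιᵘ n) ⟨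
  ℚ.toℚᵘ (ι m) ℚᵘ.* ℚ.toℚᵘ (ι n)               ≈⟨ ℚ.toℚᵘ-homo-* (ι m) (ι n) ⟨
  ℚ.toℚᵘ (ι m ℚ.* ι n)                         ∎)
  where open import Relation.Binary.Reasoning.Setoid ℚᵘ.≃-setoid

ι-cancel-≤ : ∀ {m n} → ι m ℚ.≤ ι n → m ℕ.≤ n
ι-cancel-≤ {m} {n} m≤n
  with ℚᵘ.*≤* m≤n′ ← ℚᵘ.≤-respˡ-≃ (ιᵘ m) (ℚᵘ.≤-respʳ-≃ (ιᵘ n) (ℚ.toℚᵘ-mono-≤ m≤n)) =
  ℤ.drop‿+≤+ (subst₂ ℤ._≤_ (ℤ.*-identityʳ (ℤ.+ m)) (ℤ.*-identityʳ (ℤ.+ n)) m≤n′)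

0≤ι : ∀ n → 0ℚ ℚ.≤ ι n
0≤ι n = ℚ.nonNegative⁻¹ (ι n) {{ℚ.normalize-nonNeg n 1}}

0<ι : ∀ n .{{_ : ℕ.NonZero n}} → 0ℚ ℚ.< ι n
0<ι n = ℚ.positive⁻¹ (ι n) {{ℚ.normalize-pos n 1}}

0≤p*q : ∀ {p q} → 0ℚ ℚ.≤ p → 0ℚ ℚ.≤ q → 0ℚ ℚ.≤ p ℚ.* q
0≤p*q {p} {q} 0≤p 0≤q = ℚ.nonNegative⁻¹ _
  {{ℚ.nonNeg*nonNeg⇒nonNeg p {{ℚ.nonNegative 0≤p}} q {{ℚ.nonNegative 0≤q}}}}

0≤recipℚ : ∀ {q} → 0ℚ ℚ.< q → 0ℚ ℚ.≤ recipℚ q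
0≤recipℚ {q} 0<q = ℚ.*-cancelʳ-≤-pos q {{ℚ.positive 0<q}} (begin
  0ℚ ℚ.* q         ≡⟨ ℚ.*-zeroˡ q ⟩
  0ℚ               ≤⟨ ℚ.nonNegative⁻¹ 1ℚ ⟩
  1ℚ               ≡⟨ recipℚ-inverse 0<q ⟨
  recipℚ q ℚ.* q   ∎)
  where open ℚ.≤-Reasoning

-- If q < p, take r strictly between them by density; ε = r - q then gives p ≤ r < p.
≤-up-to-ε : ∀ {p q} → (∀ ε → 0ℚ ℚ.< ε → p ℚ.≤ q ℚ.+ ε) → p ℚ.≤ q
≤-up-to-ε {p} {q} p≤q+ε = ℚ.≮⇒≥ λ q<p →
  let r , q<r , r<p = ℚ.<-dense q<p in
  ℚ.<-irrefl {r} refl (begin-strict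
    r                <⟨ r<p ⟩
    p                ≤⟨ p≤q+ε (r ℚ.- q)
                          (subst (ℚ._< r ℚ.- q) (ℚ.+-inverseʳ q) (ℚ.+-monoˡ-< (ℚ.- q) q<r)) ⟩
    q ℚ.+ (r ℚ.- q)  ≡⟨ solve 2 (λ q r → q :+ (r :- q) := r) refl q r ⟩
    r                ∎)
  where
  open ℚ.≤-Reasoning
  open +-*-Solver

-- Termwise reasoning about tails of sequences

Eventually : (ℕ → Set) → Set
Eventually P = ∃ λ N → ∀ n → N ℕ.≤ n → P n

private variable
  P Q R : ℕ → Set

always : (∀ n → P n) → Eventually P
always p = 0 , λ n _ → p n

ev-map : (∀ {n} → P n → Q n) → Eventually P → Eventually Q
ev-map f (N , p) = N , λ n N≤n → f (p n N≤n)

ev-zip : (∀ {n} → P n → Q n → R n) → Eventually P → Eventually Q → Eventually R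
ev-zip f (M , p) (N , q) = M ℕ.⊔ N , λ n ≤n →
  f (p n (ℕ.m⊔n≤o⇒m≤o M N ≤n)) (q n (ℕ.m⊔n≤o⇒n≤o M N ≤n))

ev-witness : Eventually P → ∃ P
ev-witness (N , p) = N , p N ℕ.≤-refl

-- `EventuallyNonNeg x` is stronger than `0ℝ ≤ℝ x`, which also admits negative terms tending to 0.
-- The stronger form allows termwise multiplication of inequalities.
EventuallyPos EventuallyNonNeg : ℝ → Set
EventuallyPos x = Eventually λ n → 0ℚ ℚ.< seq x n
EventuallyNonNeg x = Eventually λ n → 0ℚ ℚ.≤ seq x n

<ℝ⇒pos : ∀ {x} → 0ℝ <ℝ x → EventuallyPos x
<ℝ⇒pos {x} (mk< ε 0<ε N ε≤x) = N , λ n N≤n →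
  ℚ.<-≤-trans 0<ε (subst (ℚ._≤ seq x n) (ℚ.+-identityˡ ε) (ε≤x n N≤n))

pos⇒nonNeg : ∀ {x} → EventuallyPos x → EventuallyNonNeg x
pos⇒nonNeg = ev-map ℚ.<⇒≤

fromℕ-nonNeg : ∀ n → EventuallyNonNeg (fromℕ n)
fromℕ-nonNeg n = always λ _ → 0≤ι n

*ℝ-nonNeg : ∀ {x y} → EventuallyNonNeg x → EventuallyNonNeg y → EventuallyNonNeg (x *ℝ y)
*ℝ-nonNeg = ev-zip 0≤p*q

^ℝ-nonNeg : ∀ {x} → EventuallyNonNeg x → ∀ k → EventuallyNonNeg (x ^ℝ k)
^ℝ-nonNeg     0≤x zero    = fromℕ-nonNeg 1
^ℝ-nonNeg {x} 0≤x (suc k) = *ℝ-nonNeg {x} {x ^ℝ k} 0≤x (^ℝ-nonNeg {x} 0≤x k)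

/ℝ-nonNeg : ∀ {x} y ⦃ 0<y : 0ℝ <ℝ y ⦄ → EventuallyNonNeg x → EventuallyNonNeg (x /ℝ y)
/ℝ-nonNeg y ⦃ 0<y ⦄ 0≤x = ev-zip (λ 0≤p 0<q → 0≤p*q 0≤p (0≤recipℚ 0<q)) 0≤x (<ℝ⇒pos 0<y)

-- x ≤ℝ y unfolds to a statement about the sequences of x and y, from which
-- x and y cannot be inferred; hence the endpoints given at each use.
eventually-≤⇒≤ℝ : ∀ {x y} → Eventually (λ n → seq x n ℚ.≤ seq y n) → x ≤ℝ y
eventually-≤⇒≤ℝ {x} {y} x≤y ε 0<ε = ev-map
  (λ {n} p≤q → ℚ.≤-trans p≤q
    (subst (ℚ._≤ seq y n ℚ.+ ε) (ℚ.+-identityʳ _) (ℚ.+-monoʳ-≤ (seq y n) (ℚ.<⇒≤ 0<ε))))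
  x≤y

eventually-≡⇒≤ℝ : ∀ {x y} → Eventually (λ n → seq x n ≡ seq y n) → x ≤ℝ y
eventually-≡⇒≤ℝ {x} {y} x≡y = eventually-≤⇒≤ℝ {x} {y} (ev-map ℚ.≤-reflexive x≡y)

-- The tolerance ε is split as r + (ε - r) with 0 < r < ε.
≤ℝ-trans : ∀ {x y z} → x ≤ℝ y → y ≤ℝ z → x ≤ℝ z
≤ℝ-trans {x} {y} {z} x≤y y≤z ε 0<ε with r , 0<r , r<ε ← ℚ.<-dense 0<ε =
  ev-zip (λ {n} → step {seq x n} {seq y n} {seq z n}) (x≤y r 0<r)
    (y≤z (ε ℚ.- r) (subst (ℚ._< ε ℚ.- r) (ℚ.+-inverseʳ r) (ℚ.+-monoˡ-< (ℚ.- r) r<ε)))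
  where
  open ℚ.≤-Reasoning
  open +-*-Solver
  step : ∀ {p q s} → p ℚ.≤ q ℚ.+ r → q ℚ.≤ s ℚ.+ (ε ℚ.- r) → p ℚ.≤ s ℚ.+ ε
  step {p} {q} {s} p≤ q≤ = begin
    p                          ≤⟨ p≤ ⟩
    q ℚ.+ r                    ≤⟨ ℚ.+-monoˡ-≤ r q≤ ⟩
    s ℚ.+ (ε ℚ.- r) ℚ.+ r      ≡⟨ solve 3 (λ s ε r → s :+ (ε :- r) :+ r := s :+ ε) refl s ε r ⟩
    s ℚ.+ ε                    ∎

fromℕ-cancel-≤ : ∀ {m n} → fromℕ m ≤ℝ fromℕ n → m ℕ.≤ n
fromℕ-cancel-≤ m≤n = ι-cancel-≤ (≤-up-to-ε λ ε 0<ε → proj₂ (ev-witness (m≤n ε 0<ε)))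

+ℝ-monoˡ-≤ : ∀ {x y} z → x ≤ℝ y → x +ℝ z ≤ℝ y +ℝ z
+ℝ-monoˡ-≤ {x} {y} z x≤y ε 0<ε = ev-map (λ {n} → step {seq x n} {seq y n} {seq z n}) (x≤y ε 0<ε)
  where
  open ℚ.≤-Reasoning
  open +-*-Solver
  step : ∀ {p q r} → p ℚ.≤ q ℚ.+ ε → p ℚ.+ r ℚ.≤ q ℚ.+ r ℚ.+ ε
  step {p} {q} {r} p≤ = begin
    p ℚ.+ r          ≤⟨ ℚ.+-monoˡ-≤ r p≤ ⟩
    q ℚ.+ ε ℚ.+ r    ≡⟨ solve 3 (λ q ε r → q :+ ε :+ r := q :+ r :+ ε) refl q ε r ⟩
    q ℚ.+ r ℚ.+ ε    ∎

eventually-bounded : ∀ x → ∃ λ B → 0ℚ ℚ.< B × Eventually (λ n → seq x n ℚ.≤ B)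
eventually-bounded x with N , close ← cauchy x 1ℚ (ℚ.positive⁻¹ 1ℚ) =
  1ℚ ℚ.+ ℚ.∣ seq x N ∣ ,
  ℚ.+-mono-<-≤ (ℚ.positive⁻¹ 1ℚ) (ℚ.nonNegative⁻¹ ℚ.∣ seq x N ∣ {{ℚ.∣-∣-nonNeg (seq x N)}}) ,
  N , λ n N≤n → begin
    seq x n
      ≡⟨ solve 2 (λ a b → a := (a :- b) :+ b) refl (seq x n) (seq x N) ⟩
    (seq x n ℚ.- seq x N) ℚ.+ seq x N
      ≤⟨ ℚ.+-mono-≤ (p≤∣p∣ (seq x n ℚ.- seq x N)) (p≤∣p∣ (seq x N)) ⟩
    ℚ.∣ seq x n ℚ.- seq x N ∣ ℚ.+ ℚ.∣ seq x N ∣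
      ≤⟨ ℚ.+-monoˡ-≤ ℚ.∣ seq x N ∣ (ℚ.<⇒≤ (close n N N≤n ℕ.≤-refl)) ⟩
    1ℚ ℚ.+ ℚ.∣ seq x N ∣ ∎
  where
  open ℚ.≤-Reasoning
  open +-*-Solver
  p≤∣p∣ : ∀ p → p ℚ.≤ ℚ.∣ p ∣
  p≤∣p∣ p with ℚ.≤-total 0ℚ p
  ... | inj₁ 0≤p = ℚ.≤-reflexive (sym (ℚ.0≤p⇒∣p∣≡p 0≤p))
  ... | inj₂ p≤0 = ℚ.≤-trans p≤0 (ℚ.nonNegative⁻¹ _ {{ℚ.∣-∣-nonNeg p}})

-- Multiplying by z magnifies an error η to at most η B, where B > 0 bounds the tail of z from
-- above; hence η = ε / B.
*ℝ-monoˡ-≤ : ∀ {x y} z → EventuallyNonNeg z → x ≤ℝ y → x *ℝ z ≤ℝ y *ℝ z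
*ℝ-monoˡ-≤ {x} {y} z 0≤z x≤y ε 0<ε =
  ev-zip (λ {n} → step {seq x n} {seq y n} {seq z n}) (x≤y η 0<η) (ev-zip _,_ 0≤z z≤B)
  where
  bounded = eventually-bounded z
  B = proj₁ bounded
  0<B = proj₁ (proj₂ bounded)
  z≤B = proj₂ (proj₂ bounded)
  open ℚ.≤-Reasoning
  η : ℚ
  η = ε ℚ.* (ℚ.1/ B) {{ℚ.>-nonZero 0<B}}
  0<η : 0ℚ ℚ.< η
  0<η = ℚ.positive⁻¹ _ {{ℚ.pos*pos⇒pos ε {{ℚ.positive 0<ε}} _ {{ℚ.1/pos⇒pos B {{ℚ.positive 0<B}}}}}}
  η*B : η ℚ.* B ≡ ε
  η*B = trans (ℚ.*-assoc ε _ B)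
    (trans (cong (ε ℚ.*_) (ℚ.*-inverseˡ B {{ℚ.>-nonZero 0<B}})) (ℚ.*-identityʳ ε))
  step : ∀ {p q r} → p ℚ.≤ q ℚ.+ η → 0ℚ ℚ.≤ r × r ℚ.≤ B → p ℚ.* r ℚ.≤ q ℚ.* r ℚ.+ ε
  step {p} {q} {r} p≤ (0≤r , r≤B) = begin
    p ℚ.* r                 ≤⟨ ℚ.*-monoʳ-≤-nonNeg r {{ℚ.nonNegative 0≤r}} p≤ ⟩
    (q ℚ.+ η) ℚ.* r         ≡⟨ ℚ.*-distribʳ-+ r q η ⟩
    q ℚ.* r ℚ.+ η ℚ.* r     ≤⟨ ℚ.+-monoʳ-≤ (q ℚ.* r)
                                 (ℚ.*-monoˡ-≤-nonNeg η {{ℚ.nonNegative (ℚ.<⇒≤ 0<η)}} r≤B) ⟩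
    q ℚ.* r ℚ.+ η ℚ.* B     ≡⟨ cong (q ℚ.* r ℚ.+_) η*B ⟩
    q ℚ.* r ℚ.+ ε           ∎

*ℝ-monoʳ-≤ : ∀ {x y} z → EventuallyNonNeg z → x ≤ℝ y → z *ℝ x ≤ℝ z *ℝ y
*ℝ-monoʳ-≤ {x} {y} z 0≤z x≤y =
  ≤ℝ-trans {z *ℝ x} {x *ℝ z} {z *ℝ y}
    (eventually-≡⇒≤ℝ {z *ℝ x} {x *ℝ z} (always λ n → ℚ.*-comm (seq z n) (seq x n)))
    (≤ℝ-trans {x *ℝ z} {y *ℝ z} {z *ℝ y} (*ℝ-monoˡ-≤ {x} {y} z 0≤z x≤y)
    (eventually-≡⇒≤ℝ {y *ℝ z} {z *ℝ y} (always λ n → ℚ.*-comm (seq y n) (seq z n))))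

≤ℝ-preorder : Preorder _ _ _
≤ℝ-preorder = record
  { Carrier    = ℝ
  ; _≈_        = _≡_
  ; _≲_        = _≤ℝ_
  ; isPreorder = record
    { isEquivalence = isEquivalence
    ; reflexive     = λ { {x} refl → eventually-≡⇒≤ℝ {x} {x} (always λ _ → refl) }
    ; trans         = λ {x} {y} {z} → ≤ℝ-trans {x} {y} {z}
    }
  }

module ≤ℝ-Reasoning = Relation.Binary.Reasoning.Preorder ≤ℝ-preorder

1≤^ℝ : ∀ x → EventuallyNonNeg x → 1ℝ ≤ℝ x → ∀ k → 1ℝ ≤ℝ x ^ℝ k
1≤^ℝ x 0≤x 1≤x zero    = eventually-≡⇒≤ℝ {1ℝ} {1ℝ} (always λ _ → refl)
1≤^ℝ x 0≤x 1≤x (suc k) = begin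
  1ℝ                 ≲⟨ 1≤^ℝ x 0≤x 1≤x k ⟩
  x ^ℝ k             ≲⟨ eventually-≡⇒≤ℝ {x ^ℝ k} {1ℝ *ℝ x ^ℝ k}
                          (always λ n → sym (ℚ.*-identityˡ (seq (x ^ℝ k) n))) ⟩
  1ℝ *ℝ x ^ℝ k       ≲⟨ *ℝ-monoˡ-≤ {1ℝ} {x} (x ^ℝ k) (^ℝ-nonNeg {x} 0≤x k) 1≤x ⟩
  x *ℝ x ^ℝ k        ∎
  where open ≤ℝ-Reasoning

-- For k = 0 every term on the right is 0, while the gap ε keeps the left side positive.
<ℝ*⇒nonZero : ∀ {ℓ} x k → fromℕ ℓ <ℝ x *ℝ fromℕ k → ℕ.NonZero k
<ℝ*⇒nonZero     x (suc k) _                  = _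
<ℝ*⇒nonZero {ℓ} x zero    (mk< ε 0<ε N ℓ+ε≤) = contradiction refl (ℚ.<⇒≢ (ℚ.≤-<-trans
  (subst (ι ℓ ℚ.+ ε ℚ.≤_) (ℚ.*-zeroʳ (seq x N)) (ℓ+ε≤ N ℕ.≤-refl))
  (ℚ.+-mono-≤-< (0≤ι ℓ) 0<ε)))

-- From real bounds to inequalities between naturals

module _ (x y : ℝ) ⦃ 0<x : 0ℝ <ℝ x ⦄ ⦃ 0<y : 0ℝ <ℝ y ⦄ where

  private
    0≤x : EventuallyNonNeg x
    0≤x = pos⇒nonNeg {x} (<ℝ⇒pos 0<x)
    0≤y : EventuallyNonNeg y
    0≤y = pos⇒nonNeg {y} (<ℝ⇒pos 0<y)

  -- The chain is ℓ c ≤ (x² k / y)(y k) = (x k)² ≤ a b. With x = δ₁ and y = δ₁′ it yields ℓ n_w ≤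
  -- n_u n_v.
  ℕ-product-≤ : ∀ {ℓ k a b c} → fromℕ ℓ <ℝ (x ^ℝ 2 /ℝ y) *ℝ fromℕ k →
    x *ℝ fromℕ k ≤ℝ fromℕ a → x *ℝ fromℕ k ≤ℝ fromℕ b → fromℕ c ≤ℝ y *ℝ fromℕ k →
    ℓ ℕ.* c ℕ.≤ a ℕ.* b
  ℕ-product-≤ {ℓ} {k} {a} {b} {c} (mk< ε 0<ε N ℓ+ε≤) xk≤a xk≤b c≤yk = fromℕ-cancel-≤ (begin
    fromℕ (ℓ ℕ.* c)
      ≲⟨ eventually-≡⇒≤ℝ {fromℕ (ℓ ℕ.* c)} {fromℕ ℓ *ℝ fromℕ c} (always λ _ → ι-* ℓ c) ⟩
    fromℕ ℓ *ℝ fromℕ c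
      ≲⟨ *ℝ-monoʳ-≤ {fromℕ c} {yk} (fromℕ ℓ) (fromℕ-nonNeg ℓ) c≤yk ⟩
    fromℕ ℓ *ℝ yk
      ≲⟨ *ℝ-monoˡ-≤ {fromℕ ℓ} {x²k/y} yk (*ℝ-nonNeg {y} {fromℕ k} 0≤y (fromℕ-nonNeg k)) ℓ≤x²k/y ⟩
    x²k/y *ℝ yk
      ≲⟨ eventually-≡⇒≤ℝ {x²k/y *ℝ yk} {xk *ℝ xk}
           (ev-map (λ {n} → cancel-y {seq x n} {seq y n}) (<ℝ⇒pos 0<y)) ⟩
    xk *ℝ xk
      ≲⟨ *ℝ-monoˡ-≤ {xk} {fromℕ a} xk (*ℝ-nonNeg {x} {fromℕ k} 0≤x (fromℕ-nonNeg k)) xk≤a ⟩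
    fromℕ a *ℝ xk
      ≲⟨ *ℝ-monoʳ-≤ {xk} {fromℕ b} (fromℕ a) (fromℕ-nonNeg a) xk≤b ⟩
    fromℕ a *ℝ fromℕ b
      ≲⟨ eventually-≡⇒≤ℝ {fromℕ a *ℝ fromℕ b} {fromℕ (a ℕ.* b)} (always λ _ → sym (ι-* a b)) ⟩
    fromℕ (a ℕ.* b) ∎)
    where
    open ≤ℝ-Reasoning
    xk yk x²k/y : ℝ
    xk = x *ℝ fromℕ k
    yk = y *ℝ fromℕ k
    x²k/y = (x ^ℝ 2 /ℝ y) *ℝ fromℕ k
    ℓ≤x²k/y : fromℕ ℓ ≤ℝ x²k/y
    ℓ≤x²k/y = eventually-≤⇒≤ℝ {fromℕ ℓ} {x²k/y} (N , λ n N≤n → ℚ.≤-trans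
      (subst (ℚ._≤ ι ℓ ℚ.+ ε) (ℚ.+-identityʳ (ι ℓ)) (ℚ.+-monoʳ-≤ (ι ℓ) (ℚ.<⇒≤ 0<ε))) (ℓ+ε≤ n N≤n))
    cancel-y : ∀ {p q} → 0ℚ ℚ.< q →
      p ℚ.* (p ℚ.* 1ℚ) ℚ.* recipℚ q ℚ.* ι k ℚ.* (q ℚ.* ι k) ≡ p ℚ.* ι k ℚ.* (p ℚ.* ι k)
    cancel-y {p} {q} 0<q = trans
      (solve 4 (λ p q r k → p :* (p :* con 1ℚ) :* r :* k :* (q :* k) := p :* k :* (p :* k) :* (r :* q))
        refl p q (recipℚ q) (ι k))
      (trans (cong (p ℚ.* ι k ℚ.* (p ℚ.* ι k) ℚ.*_) (recipℚ-inverse 0<q)) (ℚ.*-identityʳ _))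
      where open +-*-Solver

  1≤/ℝ : ∀ k .{{_ : ℕ.NonZero k}} → x *ℝ fromℕ k ≤ℝ y *ℝ fromℕ k → 1ℝ ≤ℝ y /ℝ x
  1≤/ℝ k xk≤yk = begin
    1ℝ
      ≲⟨ eventually-≡⇒≤ℝ {1ℝ} {xk *ℝ 1/xk} (ev-map (λ {n} → xk-inverse {seq x n}) (<ℝ⇒pos 0<x)) ⟩
    xk *ℝ 1/xk
      ≲⟨ *ℝ-monoˡ-≤ {xk} {yk} 1/xk 0≤1/xk xk≤yk ⟩
    yk *ℝ 1/xk
      ≲⟨ eventually-≡⇒≤ℝ {yk *ℝ 1/xk} {y /ℝ x}
           (always λ n → cancel-k (seq y n) (recipℚ (seq x n))) ⟩
    y /ℝ x ∎
    where
    open ≤ℝ-Reasoning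
    open +-*-Solver
    κ = ι k
    xk yk 1/xk : ℝ
    xk = x *ℝ fromℕ k
    yk = y *ℝ fromℕ k
    -- Writing 1/(xk) as (1/k)/x makes the positivity of x suffice for the division.
    1/xk = fromℚ (recipℚ κ) /ℝ x
    0≤1/xk : EventuallyNonNeg 1/xk
    0≤1/xk = /ℝ-nonNeg {fromℚ (recipℚ κ)} x (always λ _ → 0≤recipℚ (0<ι k))
    κ-inverse : recipℚ κ ℚ.* κ ≡ 1ℚ
    κ-inverse = recipℚ-inverse (0<ι k)
    xk-inverse : ∀ {p} → 0ℚ ℚ.< p → 1ℚ ≡ p ℚ.* κ ℚ.* (recipℚ κ ℚ.* recipℚ p)
    xk-inverse {p} 0<p = sym (trans
      (solve 4 (λ p k k′ p′ → p :* k :* (k′ :* p′) := (k′ :* k) :* (p′ :* p)) refl p κ (recipℚ κ) (recipℚ p))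
      (cong₂ ℚ._*_ κ-inverse (recipℚ-inverse 0<p)))
    cancel-k : ∀ q p′ → q ℚ.* κ ℚ.* (recipℚ κ ℚ.* p′) ≡ q ℚ.* p′
    cancel-k q p′ = trans
      (solve 4 (λ q k k′ p′ → q :* k :* (k′ :* p′) := (k′ :* k) :* (q :* p′)) refl q κ (recipℚ κ) p′)
      (trans (cong (ℚ._* (q ℚ.* p′)) κ-inverse) (ℚ.*-identityˡ _))

-- Applied with ρ = δ₁′ / δ₁, z = δ₂′ and q = ℓ - 1; here `G` is the number of relations.
module _ (ρ z : ℝ) (0≤ρ : EventuallyNonNeg ρ) (0≤z : EventuallyNonNeg z)
  (c q G : ℕ) ⦃ 0<q : 0ℝ <ℝ fromℕ q ⦄
  (G-large : fromℕ 2 *ℝ ρ ^ℝ 3 *ℝ z *ℝ (fromℕ c /ℝ fromℕ q) +ℝ fromℕ 2 ≤ℝ fromℕ G)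
  where

  private
    ρ³ main : ℝ
    ρ³ = ρ ^ℝ 3
    main = fromℕ 2 *ℝ ρ³ *ℝ z *ℝ (fromℕ c /ℝ fromℕ q)

  large⇒≥2 : 2 ℕ.≤ G
  large⇒≥2 = fromℕ-cancel-≤ (begin
    fromℕ 2         ≲⟨ eventually-≤⇒≤ℝ {fromℕ 2} {main +ℝ fromℕ 2} (ev-map p≤q+p 0≤main) ⟩
    main +ℝ fromℕ 2 ≲⟨ G-large ⟩
    fromℕ G         ∎)
    where
    open ≤ℝ-Reasoning
    p≤q+p : ∀ {q} → 0ℚ ℚ.≤ q → ι 2 ℚ.≤ q ℚ.+ ι 2
    p≤q+p {q} 0≤q = subst (ℚ._≤ q ℚ.+ ι 2) (ℚ.+-identityˡ (ι 2)) (ℚ.+-monoˡ-≤ (ι 2) 0≤q)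
    0≤main : EventuallyNonNeg main
    0≤main = *ℝ-nonNeg {fromℕ 2 *ℝ ρ³ *ℝ z} {fromℕ c /ℝ fromℕ q}
      (*ℝ-nonNeg {fromℕ 2 *ℝ ρ³} {z}
        (*ℝ-nonNeg {fromℕ 2} {ρ³} (fromℕ-nonNeg 2) (^ℝ-nonNeg {ρ} 0≤ρ 3)) 0≤z)
      (/ℝ-nonNeg {fromℕ c} (fromℕ q) (fromℕ-nonNeg c))

  -- Multiplying `G-large` by q clears the division, and ρ³ ≥ 1 lets the factor ρ³ be discarded. The
  -- number i will be some c(h).
  large⇒2*i+2*q≤ : ∀ {i} → 1ℝ ≤ℝ ρ → fromℕ i ≤ℝ z *ℝ fromℕ c → 2 ℕ.* i ℕ.+ 2 ℕ.* q ℕ.≤ G ℕ.* q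
  large⇒2*i+2*q≤ {i} 1≤ρ i≤zc = fromℕ-cancel-≤ (begin
    fromℕ (2 ℕ.* i ℕ.+ 2 ℕ.* q)
      ≲⟨ eventually-≡⇒≤ℝ {fromℕ (2 ℕ.* i ℕ.+ 2 ℕ.* q)} {2ℝ *ℝ fromℕ i +ℝ 2q}
           (always λ _ → trans (ι-+ (2 ℕ.* i) (2 ℕ.* q)) (cong₂ ℚ._+_ (ι-* 2 i) (ι-* 2 q))) ⟩
    2ℝ *ℝ fromℕ i +ℝ 2q
      ≲⟨ +ℝ-monoˡ-≤ {2ℝ *ℝ fromℕ i} {2zc} 2q (*ℝ-monoʳ-≤ {fromℕ i} {z *ℝ fromℕ c} 2ℝ (fromℕ-nonNeg 2) i≤zc) ⟩
    2zc +ℝ 2q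
      ≲⟨ eventually-≡⇒≤ℝ {2zc +ℝ 2q} {1ℝ *ℝ 2zc +ℝ 2q}
           (always λ n → cong (ℚ._+ seq 2q n) (sym (ℚ.*-identityˡ (seq 2zc n)))) ⟩
    1ℝ *ℝ 2zc +ℝ 2q
      ≲⟨ +ℝ-monoˡ-≤ {1ℝ *ℝ 2zc} {ρ³ *ℝ 2zc} 2q
           (*ℝ-monoˡ-≤ {1ℝ} {ρ³} 2zc 0≤2zc (1≤^ℝ ρ 0≤ρ 1≤ρ 3)) ⟩
    ρ³ *ℝ 2zc +ℝ 2q
      ≲⟨ eventually-≡⇒≤ℝ {ρ³ *ℝ 2zc +ℝ 2q} {(main +ℝ 2ℝ) *ℝ fromℕ q}
           (ev-map (λ {n} 0<q → sym (clear-q {ι 2} (seq ρ³ n) (seq z n) (ι c) 0<q)) (<ℝ⇒pos 0<q)) ⟩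
    (main +ℝ 2ℝ) *ℝ fromℕ q
      ≲⟨ *ℝ-monoˡ-≤ {main +ℝ 2ℝ} {fromℕ G} (fromℕ q) (fromℕ-nonNeg q) G-large ⟩
    fromℕ G *ℝ fromℕ q
      ≲⟨ eventually-≡⇒≤ℝ {fromℕ G *ℝ fromℕ q} {fromℕ (G ℕ.* q)} (always λ _ → sym (ι-* G q)) ⟩
    fromℕ (G ℕ.* q) ∎)
    where
    open ≤ℝ-Reasoning
    2ℝ 2q 2zc : ℝ
    2ℝ = fromℕ 2
    2q = 2ℝ *ℝ fromℕ q
    2zc = 2ℝ *ℝ (z *ℝ fromℕ c)
    0≤2zc : EventuallyNonNeg 2zc
    0≤2zc = *ℝ-nonNeg {2ℝ} {z *ℝ fromℕ c} (fromℕ-nonNeg 2)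
      (*ℝ-nonNeg {z} {fromℕ c} 0≤z (fromℕ-nonNeg c))
    clear-q : ∀ {t} r s u {q} → 0ℚ ℚ.< q →
      (t ℚ.* r ℚ.* s ℚ.* (u ℚ.* recipℚ q) ℚ.+ t) ℚ.* q ≡ r ℚ.* (t ℚ.* (s ℚ.* u)) ℚ.+ t ℚ.* q
    clear-q {t} r s u {q} 0<q = trans
      (solve 6 (λ t r s u q q′ →
          (t :* r :* s :* (u :* q′) :+ t) :* q := r :* (t :* (s :* u)) :* (q′ :* q) :+ t :* q)
        refl t r s u q (recipℚ q))
      (cong (ℚ._+ t ℚ.* q) (trans (cong (r ℚ.* (t ℚ.* (s ℚ.* u)) ℚ.*_) (recipℚ-inverse 0<q))
        (ℚ.*-identityʳ (r ℚ.* (t ℚ.* (s ℚ.* u))))))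
      where open +-*-Solver

-- Finite sums and indicator functions

sum-mono-≤ : ∀ {n} {f g : Fin n → ℕ} → (∀ i → f i ≤ g i) → sum f ≤ sum g
sum-mono-≤ {zero}  f≤g = z≤n
sum-mono-≤ {suc n} f≤g = +-mono-≤ (f≤g zero) (sum-mono-≤ (f≤g ∘ suc))

sum-mono-< : ∀ {n} {f g : Fin n → ℕ} → (∀ i → f i ≤ g i) →
             ∀ j → f j < g j → sum f < sum g
sum-mono-< f≤g zero    fj<gj = +-mono-<-≤ fj<gj (sum-mono-≤ (f≤g ∘ suc))
sum-mono-< f≤g (suc j) fj<gj = +-mono-≤-< (f≤g zero) (sum-mono-< (f≤g ∘ suc) j fj<gj)

sum-const : ∀ n x → ∑[ i < n ] x ≡ n * x
sum-const zero    x = refl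
sum-const (suc n) x = cong (x +_) (sum-const n x)

term≤sum : ∀ {n} (f : Fin n → ℕ) i → f i ≤ sum f
term≤sum f zero    = m≤m+n _ _
term≤sum f (suc i) = ≤-trans (term≤sum (f ∘ suc) i) (m≤n+m _ _)

private variable
  A B : Set

𝟙 : Dec A → ℕ
𝟙 A? = if does A? then 1 else 0

𝟙-yes : (A? : Dec A) → A → 𝟙 A? ≡ 1
𝟙-yes (yes _) p = refl
𝟙-yes (no ¬p) p = contradiction p ¬p

𝟙-no : (A? : Dec A) → ¬ A → 𝟙 A? ≡ 0
𝟙-no (yes p) ¬p = contradiction p ¬p
𝟙-no (no _)  ¬p = refl

𝟙-mono : (A? : Dec A) (B? : Dec B) → (A → B) → 𝟙 A? ≤ 𝟙 B?
𝟙-mono (yes p) B? A⇒B = ≤-reflexive (sym (𝟙-yes B? (A⇒B p)))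
𝟙-mono (no _)  B? A⇒B = z≤n

𝟙-cong : (A? : Dec A) (B? : Dec B) → (A → B) → (B → A) → 𝟙 A? ≡ 𝟙 B?
𝟙-cong A? B? A⇒B B⇒A = ≤-antisym (𝟙-mono A? B? A⇒B) (𝟙-mono B? A? B⇒A)

𝟙-× : (A? : Dec A) (B? : Dec B) → 𝟙 (A? ×-dec B?) ≡ 𝟙 A? * 𝟙 B?
𝟙-× (yes _) (yes _) = refl
𝟙-× (yes _) (no _)  = refl
𝟙-× (no _)  _       = refl

𝟙-idem : (A? : Dec A) → 𝟙 A? * 𝟙 A? ≡ 𝟙 A?
𝟙-idem (yes _) = refl
𝟙-idem (no _)  = refl

-- Stated for an arbitrary `f` because the tail of `allFin` is tabulated from `suc`, so induction
-- needs more than the identity.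
length-filter-tabulate : ∀ {n} {P : Pred A 0ℓ} (P? : Decidable P) (f : Fin n → A) →
                         length (filter P? (tabulate f)) ≡ ∑[ i < n ] 𝟙 (P? (f i))
length-filter-tabulate {n = zero}  P? f = refl
length-filter-tabulate {n = suc n} P? f with does (P? (f zero))
... | true  = cong suc (length-filter-tabulate P? (f ∘ suc))
... | false = length-filter-tabulate P? (f ∘ suc)

#≡sum : ∀ {n} {P : Pred (Fin n) 0ℓ} (P? : Decidable P) → # P? ≡ ∑[ i < n ] 𝟙 (P? i)
#≡sum P? = length-filter-tabulate P? id

sum-𝟙-≟ : ∀ {n} (j : Fin n) (f : Fin n → ℕ) → ∑[ i < n ] (𝟙 (j ≟ᶠ i) * f i) ≡ f j
sum-𝟙-≟ {suc n} zero    f = trans (cong₂ _+_ (*-identityˡ (f zero)) (sum-replicate-zero n)) (+-identityʳ _)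
sum-𝟙-≟ {suc n} (suc j) f = sum-𝟙-≟ j (f ∘ suc)

∃-minimizer : ∀ {n} {P : Pred (Fin n) 0ℓ} → Decidable P → (f : Fin n → ℕ) → ∃ P →
              ∃ λ i → P i × (∀ j → P j → f i ≤ f j)
∃-minimizer {n} P? f (i , Pi) =
  let js = filter P? (allFin n) in
  -- The given witness `i` is the default value of `argmin`; it satisfies `P`, as do all members of
  -- `js`.
  argmin f i js
  , argmin-all f Pi (all-filter P? (allFin n))
  , λ j Pj → All.lookup (f[argmin]≤f[xs] i js) (∈-filter⁺ P? (∈-allFin j) Pj)

-- (2a − ℓ)² ≥ 0
4ℓa≤4a²+ℓ² : ∀ ℓ a → 4 * (ℓ * a) ≤ 4 * (a * a) + ℓ * ℓ
4ℓa≤4a²+ℓ² ℓ a with ≤-total ℓ (2 * a)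
... | inj₁ ℓ≤2a with k , eq ← m≤n⇒∃[o]m+o≡n ℓ≤2a = begin
    4 * (ℓ * a)               ≡⟨ lemma₁ ℓ a ⟩
    2 * (ℓ * (2 * a))         ≡⟨ cong (λ z → 2 * (ℓ * z)) eq ⟨
    2 * (ℓ * (ℓ + k))         ≤⟨ m≤m+n _ (k * k) ⟩
    2 * (ℓ * (ℓ + k)) + k * k ≡⟨ lemma₂ ℓ k ⟩
    (ℓ + k) * (ℓ + k) + ℓ * ℓ ≡⟨ cong (λ z → z * z + ℓ * ℓ) eq ⟩
    2 * a * (2 * a) + ℓ * ℓ   ≡⟨ lemma₃ ℓ a ⟩
    4 * (a * a) + ℓ * ℓ       ∎
  where
  open ≤-Reasoning
  lemma₁ : ∀ ℓ a → 4 * (ℓ * a) ≡ 2 * (ℓ * (2 * a))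
  lemma₁ = solve-∀
  lemma₂ : ∀ ℓ k → 2 * (ℓ * (ℓ + k)) + k * k ≡ (ℓ + k) * (ℓ + k) + ℓ * ℓ
  lemma₂ = solve-∀
  lemma₃ : ∀ ℓ a → 2 * a * (2 * a) + ℓ * ℓ ≡ 4 * (a * a) + ℓ * ℓ
  lemma₃ = solve-∀
... | inj₂ 2a≤ℓ with k , refl ← m≤n⇒∃[o]m+o≡n 2a≤ℓ = begin
    4 * ((2 * a + k) * a)                 ≤⟨ m≤m+n _ (k * k) ⟩
    4 * ((2 * a + k) * a) + k * k         ≡⟨ lemma a k ⟩
    4 * (a * a) + (2 * a + k) * (2 * a + k) ∎
  where
  open ≤-Reasoning
  lemma : ∀ a k → 4 * ((2 * a + k) * a) + k * k ≡ 4 * (a * a) + (2 * a + k) * (2 * a + k)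
  lemma = solve-∀

-- For a = 0 the left side vanishes, and for a ≥ ℓ already ℓ a ≤ a². The correction ℓ² is thus paid
-- only when 0 < a < ℓ.
4ℓa≤4a²+ℓ²-if-exceptional : ∀ ℓ a (exc? : Dec (0 < a × a < ℓ)) →
                            4 * (ℓ * a) ≤ 4 * (a * a) + 𝟙 exc? * (ℓ * ℓ)
4ℓa≤4a²+ℓ²-if-exceptional ℓ a (yes _) =
  ≤-trans (4ℓa≤4a²+ℓ² ℓ a) (≤-reflexive (cong (4 * (a * a) +_) (sym (+-identityʳ (ℓ * ℓ)))))
4ℓa≤4a²+ℓ²-if-exceptional ℓ zero (no _) = ≤-trans (≤-reflexive (cong (4 *_) (*-zeroʳ ℓ))) z≤n
4ℓa≤4a²+ℓ²-if-exceptional ℓ a@(suc _) (no a-unexc) = ≤-trans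
  (*-monoʳ-≤ 4 (*-monoˡ-≤ a (≮⇒≥ λ a<ℓ → a-unexc (z<s , a<ℓ))))
  (m≤m+n _ _)

m≤m² : ∀ m → m ≤ m * m
m≤m² zero    = z≤n
m≤m² (suc m) = m≤m*n (suc m) (suc m)

-- Weighted sums over pairs

module Quadratic {n} (p : Fin n → ℕ) where

  open ≡-Reasoning

  -- When p is the indicator of a set, this is the sum of F over all ordered pairs from that set.
  form : (Fin n → Fin n → ℕ) → ℕ
  form F = ∑[ i < n ] ∑[ j < n ] (p i * p j * F i j)

  form-mono : ∀ {F F′} → (∀ i j → F i j ≤ F′ i j) → form F ≤ form F′
  form-mono F≤F′ = sum-mono-≤ λ i → sum-mono-≤ λ j → *-monoʳ-≤ (p i * p j) (F≤F′ i j)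

  form-+ : ∀ F F′ → form (λ i j → F i j + F′ i j) ≡ form F + form F′
  form-+ F F′ = begin
    ∑[ i < n ] ∑[ j < n ] (p i * p j * (F i j + F′ i j))
      ≡⟨ (sum-cong-≗ λ i → sum-cong-≗ λ j → *-distribˡ-+ (p i * p j) (F i j) (F′ i j)) ⟩
    ∑[ i < n ] ∑[ j < n ] (p i * p j * F i j + p i * p j * F′ i j)
      ≡⟨ (sum-cong-≗ λ i → ∑-distrib-+ (λ j → p i * p j * F i j) _) ⟩
    ∑[ i < n ] ((∑[ j < n ] (p i * p j * F i j)) + (∑[ j < n ] (p i * p j * F′ i j)))
      ≡⟨ ∑-distrib-+ (λ i → ∑[ j < n ] (p i * p j * F i j)) _ ⟩
    form F + form F′ ∎

  form-const : ∀ x → form (λ _ _ → x) ≡ sum p * sum p * x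
  form-const x = begin
    ∑[ i < n ] ∑[ j < n ] (p i * p j * x)
      ≡⟨ (sum-cong-≗ λ i → *-distribʳ-sum x (λ j → p i * p j)) ⟨
    ∑[ i < n ] ((∑[ j < n ] (p i * p j)) * x)
      ≡⟨ *-distribʳ-sum x (λ i → ∑[ j < n ] (p i * p j)) ⟨
    (∑[ i < n ] ∑[ j < n ] (p i * p j)) * x
      ≡⟨ cong (_* x) (sum-cong-≗ λ i → *-distribˡ-sum (p i) p) ⟨
    (∑[ i < n ] (p i * sum p)) * x
      ≡⟨ cong (_* x) (*-distribʳ-sum (sum p) p) ⟨
    sum p * sum p * x ∎

  form-diagonal : (∀ i → p i * p i ≡ p i) → ∀ x → form (λ i j → 𝟙 (i ≟ᶠ j) * x) ≡ sum p * x
  form-diagonal idem x = begin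
    ∑[ i < n ] ∑[ j < n ] (p i * p j * (𝟙 (i ≟ᶠ j) * x))
      ≡⟨ (sum-cong-≗ λ i → sum-cong-≗ λ j → lemma (p i) (p j) (𝟙 (i ≟ᶠ j)) x) ⟩
    ∑[ i < n ] ∑[ j < n ] (𝟙 (i ≟ᶠ j) * (p i * p j * x))
      ≡⟨ (sum-cong-≗ λ i → sum-𝟙-≟ i (λ j → p i * p j * x)) ⟩
    ∑[ i < n ] (p i * p i * x)
      ≡⟨ (sum-cong-≗ λ i → cong (_* x) (idem i)) ⟩
    ∑[ i < n ] (p i * x)
      ≡⟨ *-distribʳ-sum x p ⟨
    sum p * x ∎
    where
    lemma : ∀ a b d x → a * b * (d * x) ≡ d * (a * b * x)
    lemma = solve-∀

  form-sum : ∀ {m} (F : Fin m → Fin n → Fin n → ℕ) →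
             ∑[ k < m ] form (F k) ≡ form (λ i j → ∑[ k < m ] F k i j)
  form-sum {m} F = begin
    ∑[ k < m ] ∑[ i < n ] ∑[ j < n ] (p i * p j * F k i j)
      ≡⟨ ∑-comm (λ k i → ∑[ j < n ] (p i * p j * F k i j)) ⟩
    ∑[ i < n ] ∑[ k < m ] ∑[ j < n ] (p i * p j * F k i j)
      ≡⟨ (sum-cong-≗ λ i → ∑-comm (λ k j → p i * p j * F k i j)) ⟩
    ∑[ i < n ] ∑[ j < n ] ∑[ k < m ] (p i * p j * F k i j)
      ≡⟨ (sum-cong-≗ λ i → sum-cong-≗ λ j → *-distribˡ-sum (p i * p j) (λ k → F k i j)) ⟨
    form (λ i j → ∑[ k < m ] F k i j) ∎

  -- Used to read the square of a path count as a count of pairs of paths.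
  square-form : ∀ (a : Fin n → ℕ) →
    (∑[ i < n ] (p i * a i)) * (∑[ i < n ] (p i * a i)) ≡ form (λ i j → a i * a j)
  square-form a = begin
    (∑[ i < n ] (p i * a i)) * (∑[ j < n ] (p j * a j))
      ≡⟨ *-distribʳ-sum _ (λ i → p i * a i) ⟩
    ∑[ i < n ] (p i * a i * (∑[ j < n ] (p j * a j)))
      ≡⟨ (sum-cong-≗ λ i → *-distribˡ-sum (p i * a i) (λ j → p j * a j)) ⟩
    ∑[ i < n ] ∑[ j < n ] (p i * a i * (p j * a j))
      ≡⟨ (sum-cong-≗ λ i → sum-cong-≗ λ j → [m*n]*[o*p]≡[m*o]*[n*p] (p i) (a i) (p j) (a j)) ⟩
    form (λ i j → a i * a j) ∎

-- Counting in association schemes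

module _ (S : AssociationScheme) where
  open AssociationScheme S

  -- The (α, β) entry of the adjacency matrix of g.
  e : X → X → G → ℕ
  e α β g = 𝟙 (⟨ α , β ⟩∈? g)

  relation : X → X → G
  relation α β = proj₁ (partition α β)

  ∈-relation : ∀ α β → ⟨ α , β ⟩∈ relation α β
  ∈-relation α β = proj₁ (proj₂ (partition α β))

  relation-unique : ∀ {α β g h} → ⟨ α , β ⟩∈ g → ⟨ α , β ⟩∈ h → g ≡ h
  relation-unique {α} {β} g∋ h∋ =
    let unique = proj₂ (proj₂ (partition α β)) in trans (sym (unique g∋)) (unique h∋)

  e-* : ∀ α β g → e β α (g *ᴳ) ≡ e α β g
  e-* α β g = 𝟙-cong (⟨ β , α ⟩∈? (g *ᴳ)) (⟨ α , β ⟩∈? g) (to (*-spec g α β)) (from (*-spec g α β))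

  c-sum : ∀ f g {h α β} → ⟨ α , β ⟩∈ h →
          c^ h [ f , g ] ≡ ∑[ γ < ∣X∣ ] (e α γ f * e γ β g)
  c-sum f g {h} {α} {β} h∋ = trans (c-spec f g h α β h∋)
    (trans (#≡sum (λ γ → ⟨ α , γ ⟩∈? f ×-dec ⟨ γ , β ⟩∈? g))
      (sum-cong-≗ λ γ → 𝟙-× (⟨ α , γ ⟩∈? f) (⟨ γ , β ⟩∈? g)))

  valency-sum : ∀ α g → ∑[ β < ∣X∣ ] e α β g ≡ valency g
  valency-sum α g = sym (trans (c-sum g (g *ᴳ) (from (𝟏-spec α α) refl))
    (sum-cong-≗ λ β → trans (cong (e α β g *_) (e-* α β g)) (𝟙-idem (⟨ α , β ⟩∈? g))))

  -- The number of points γ with r(α,γ) = r(β,γ), sorted by that shared relation.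
  common : X → X → ℕ
  common α β = ∑[ g < ∣G∣ ] ∑[ γ < ∣X∣ ] (e α γ g * e β γ g)

  common-indistinguishing : ∀ {α β g} → ⟨ α , β ⟩∈ g → common α β ≡ indistinguishing g
  common-indistinguishing {α} {β} g∋ = sum-cong-≗ λ v → sym
    (trans (c-sum v (v *ᴳ) g∋) (sum-cong-≗ λ γ → cong (e α γ v *_) (e-* β γ v)))

  -- Both sides equal the number of points. The sum of valencies is the useful form, since the lower
  -- bound produces the same sum and the two cancel.
  common-self : ∀ α → common α α ≡ ∑[ g < ∣G∣ ] valency g
  common-self α = sum-cong-≗ λ g →
    trans (sum-cong-≗ λ γ → 𝟙-idem (⟨ α , γ ⟩∈? g)) (valency-sum α g)

  valency-pos : ∀ g → 0 < valency g
  valency-pos g with α , β , g∋ ← nonempty g =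
    subst₂ _≤_ (𝟙-yes (⟨ α , β ⟩∈? g) g∋) (valency-sum α g) (term≤sum (λ γ → e α γ g) β)

  -- A pair of g lies in g** as well, and no pair lies in two relations.
  involutive : ∀ g → (g *ᴳ) *ᴳ ≡ g
  involutive g with α , β , g∋ ← nonempty g =
    relation-unique (from (*-spec (g *ᴳ) β α) (from (*-spec g α β) g∋)) g∋

  *≢𝟏 : ∀ {g} → g ≢ 𝟏 → g *ᴳ ≢ 𝟏
  *≢𝟏 {g} g≢𝟏 g*≡𝟏 with α , β , g∋ ← nonempty g =
    g≢𝟏 (relation-unique g∋ (from (𝟏-spec α β) (sym
      (to (𝟏-spec β α) (subst (⟨ β , α ⟩∈_) g*≡𝟏 (from (*-spec g α β) g∋))))))

  ∃≢𝟏 : 2 ≤ ∣G∣ → ∃ λ g → g ≢ 𝟏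
  ∃≢𝟏 2≤∣G∣ = other 2≤∣G∣ 𝟏
    where
    other : ∀ {n} → 2 ≤ n → (i : Fin n) → ∃ λ j → j ≢ i
    other (s≤s (s≤s _)) zero    = suc zero , λ ()
    other (s≤s (s≤s _)) (suc i) = zero , λ ()

  -- Two-step paths from a fixed point

  module Paths (m : G) (α : X) where

    p : X → ℕ
    p γ = e α γ m

    -- This is a_v(β).
    paths : G → X → ℕ
    paths v β = ∑[ γ < ∣X∣ ] (p γ * e γ β v)

    -- The first subscript is u* for u = m*, hence the double star.
    c≡paths : ∀ v {w β} → ⟨ α , β ⟩∈ w → c^ w [ (m *ᴳ) *ᴳ , v ] ≡ paths v β
    c≡paths v w∋ rewrite involutive m = c-sum m v w∋

    -- With the endpoint free, the first step can be chosen in n_m ways and then the second in n_v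
    -- ways.
    sum-paths : ∀ v → ∑[ β < ∣X∣ ] paths v β ≡ valency m * valency v
    sum-paths v = begin
      ∑[ β < ∣X∣ ] ∑[ γ < ∣X∣ ] (p γ * e γ β v) ≡⟨ ∑-comm (λ β γ → p γ * e γ β v) ⟩
      ∑[ γ < ∣X∣ ] ∑[ β < ∣X∣ ] (p γ * e γ β v) ≡⟨ (sum-cong-≗ λ γ → *-distribˡ-sum (p γ) (λ β → e γ β v)) ⟨
      ∑[ γ < ∣X∣ ] (p γ * (∑[ β < ∣X∣ ] e γ β v)) ≡⟨ (sum-cong-≗ λ γ → cong (p γ *_) (valency-sum γ v)) ⟩
      ∑[ γ < ∣X∣ ] (p γ * valency v)            ≡⟨ *-distribʳ-sum (valency v) p ⟨
      sum p * valency v                       ≡⟨ cong (_* valency v) (valency-sum α m) ⟩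
      valency m * valency v                   ∎
      where open ≡-Reasoning

    paths-back : paths (m *ᴳ) α ≡ valency m
    paths-back = trans
      (sum-cong-≗ λ γ → trans (cong (p γ *_) (e-* α γ m)) (𝟙-idem (⟨ α , γ ⟩∈? m)))
      (valency-sum α m)

    sum-paths² : G → ℕ
    sum-paths² v = ∑[ β < ∣X∣ ] (paths v β * paths v β)

    open Quadratic p

    -- Double counting: a_v(β)² counts pairs (γ,γ′) of midpoints, and for a fixed pair the sum over
    -- v and β counts the β with r(γ,β) = r(γ′,β).
    sum-sum-paths² : ∑[ v < ∣G∣ ] sum-paths² v ≡ form common
    sum-sum-paths² = begin
      ∑[ v < ∣G∣ ] ∑[ β < ∣X∣ ] (paths v β * paths v β)
        ≡⟨ (sum-cong-≗ λ v → sum-cong-≗ λ β → square-form (λ γ → e γ β v)) ⟩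
      ∑[ v < ∣G∣ ] ∑[ β < ∣X∣ ] form (λ γ γ′ → e γ β v * e γ′ β v)
        ≡⟨ (sum-cong-≗ λ v → form-sum (λ β γ γ′ → e γ β v * e γ′ β v)) ⟩
      ∑[ v < ∣G∣ ] form (λ γ γ′ → ∑[ β < ∣X∣ ] (e γ β v * e γ′ β v))
        ≡⟨ form-sum (λ v γ γ′ → ∑[ β < ∣X∣ ] (e γ β v * e γ′ β v)) ⟩
      form common ∎
      where open ≡-Reasoning

    module _ {d} (indist≤ : ∀ h → h ≢ 𝟏 → 2 * indistinguishing h ≤ d) where

      private
        n = valency m
        N = ∑[ g < ∣G∣ ] valency g

      -- Off the diagonal this is 2 c(h) ≤ d for h = r(γ,γ′); on it, both sides agree. Adding d to
      -- the left on the diagonal avoids truncated subtraction.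
      common-bound : ∀ γ γ′ → common γ γ′ + common γ γ′ + 𝟙 (γ ≟ᶠ γ′) * d ≤ d + 𝟙 (γ ≟ᶠ γ′) * (2 * N)
      common-bound γ γ′ with γ ≟ᶠ γ′
      ... | yes refl rewrite common-self γ = ≤-reflexive (lemma N d)
        where
        lemma : ∀ N d → N + N + 1 * d ≡ d + 1 * (2 * N)
        lemma = solve-∀
      ... | no γ≢γ′ rewrite common-indistinguishing (∈-relation γ γ′) = +-mono-≤
        (≤-trans (≤-reflexive (cong (indistinguishing g +_) (sym (+-identityʳ _))))
          (indist≤ g λ g≡𝟏 → γ≢γ′ (to (𝟏-spec γ γ′) (subst (⟨ γ , γ′ ⟩∈_) g≡𝟏 (∈-relation γ γ′)))))
        z≤n
        where g = relation γ γ′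

      -- `common-bound` summed over the n² pairs from αm, of which n are diagonal.
      sum-paths²-upper : 2 * (∑[ v < ∣G∣ ] sum-paths² v) + n * d ≤ n * n * d + n * (2 * N)
      sum-paths²-upper = subst₂ _≤_ lhs rhs (form-mono common-bound)
        where
        open ≡-Reasoning
        sum-p = valency-sum α m
        idem : ∀ γ → p γ * p γ ≡ p γ
        idem γ = 𝟙-idem (⟨ α , γ ⟩∈? m)
        T = ∑[ v < ∣G∣ ] sum-paths² v
        lhs : form (λ γ γ′ → common γ γ′ + common γ γ′ + 𝟙 (γ ≟ᶠ γ′) * d) ≡ 2 * T + n * d
        lhs = begin
          form (λ γ γ′ → common γ γ′ + common γ γ′ + 𝟙 (γ ≟ᶠ γ′) * d)
            ≡⟨ form-+ (λ γ γ′ → common γ γ′ + common γ γ′) (λ γ γ′ → 𝟙 (γ ≟ᶠ γ′) * d) ⟩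
          form (λ γ γ′ → common γ γ′ + common γ γ′) + form (λ γ γ′ → 𝟙 (γ ≟ᶠ γ′) * d)
            ≡⟨ cong₂ _+_ (form-+ common common) (form-diagonal idem d) ⟩
          form common + form common + sum p * d
            ≡⟨ cong₂ _+_ (cong (λ t → t + t) (sym sum-sum-paths²)) (cong (_* d) sum-p) ⟩
          T + T + n * d
            ≡⟨ cong (λ t → T + t + n * d) (+-identityʳ T) ⟨
          2 * T + n * d ∎
        rhs : form (λ γ γ′ → d + 𝟙 (γ ≟ᶠ γ′) * (2 * N)) ≡ n * n * d + n * (2 * N)
        rhs = begin
          form (λ γ γ′ → d + 𝟙 (γ ≟ᶠ γ′) * (2 * N))
            ≡⟨ form-+ (λ γ γ′ → d) (λ γ γ′ → 𝟙 (γ ≟ᶠ γ′) * (2 * N)) ⟩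
          form (λ γ γ′ → d) + form (λ γ γ′ → 𝟙 (γ ≟ᶠ γ′) * (2 * N))
            ≡⟨ cong₂ _+_ (form-const d) (form-diagonal idem (2 * N)) ⟩
          sum p * sum p * d + sum p * (2 * N)
            ≡⟨ cong (λ s → s * s * d + s * (2 * N)) sum-p ⟩
          n * n * d + n * (2 * N) ∎

    Exceptional : ℕ → G → X → Set
    Exceptional ℓ v β = 0 < paths v β × paths v β < ℓ

    exceptional? : ∀ ℓ v → Decidable (Exceptional ℓ v)
    exceptional? ℓ v β = (0 <? paths v β) ×-dec (paths v β <? ℓ)

    -- With ℓ = q + 1 and N = n_m n_v, summing the pointwise bounds gives 4ℓN ≤ 4 Σ a² + ℓ² s, where
    -- s counts the exceptional β. Since ℓ s ≤ N, this leaves 3ℓN ≤ 4 Σ a².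
    sum-paths²-lower : ∀ {q v} → 0 < q →
      (∀ {β β′} → Exceptional (suc q) v β → Exceptional (suc q) v β′ → relation α β ≡ relation α β′) →
      (∀ {β} → Exceptional (suc q) v β → suc q * valency (relation α β) ≤ valency m * valency v) →
      q * (valency m * valency v) + 2 * (valency m * valency v) ≤ 2 * sum-paths² v
    sum-paths²-lower {q} {v} 0<q unique small = *-cancelˡ-≤ 2 (+-cancelʳ-≤ (ℓ * N) _ _ (begin
      -- The slack is 3ℓ - 2(q + 2) = q - 1, which is nonnegative because ℓ ≥ 2.
      2 * (q * N + 2 * N) + ℓ * N                          ≤⟨ m≤m+n _ (pred q * N) ⟩
      2 * (q * N + 2 * N) + ℓ * N + pred q * N             ≡⟨ regroup 0<q ⟩
      4 * (ℓ * N)                                          ≡⟨ cong (λ t → 4 * (ℓ * t)) (sum-paths v) ⟨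
      4 * (ℓ * (∑[ β < ∣X∣ ] a β))                         ≡⟨ cong (4 *_) (*-distribˡ-sum ℓ a) ⟩
      4 * (∑[ β < ∣X∣ ] (ℓ * a β))                         ≡⟨ *-distribˡ-sum 4 (λ β → ℓ * a β) ⟩
      ∑[ β < ∣X∣ ] (4 * (ℓ * a β))                         ≤⟨ sum-mono-≤ (λ β →
        4ℓa≤4a²+ℓ²-if-exceptional ℓ (a β) (exceptional? ℓ v β)) ⟩
      ∑[ β < ∣X∣ ] (4 * (a β * a β) + s β * (ℓ * ℓ))       ≡⟨ ∑-distrib-+ (λ β → 4 * (a β * a β)) _ ⟩
      (∑[ β < ∣X∣ ] (4 * (a β * a β))) + (∑[ β < ∣X∣ ] (s β * (ℓ * ℓ)))
        ≡⟨ cong₂ _+_ (*-distribˡ-sum 4 (λ β → a β * a β)) (*-distribʳ-sum (ℓ * ℓ) s) ⟨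
      4 * sum-paths² v + sum s * (ℓ * ℓ)                   ≡⟨ cong (4 * sum-paths² v +_) (shuffle (sum s) ℓ) ⟩
      4 * sum-paths² v + ℓ * (ℓ * sum s)                   ≤⟨ +-monoʳ-≤ (4 * sum-paths² v) (*-monoʳ-≤ ℓ count) ⟩
      4 * sum-paths² v + ℓ * N                             ≡⟨ cong (_+ ℓ * N) (*-assoc 2 2 (sum-paths² v)) ⟩
      2 * (2 * sum-paths² v) + ℓ * N                       ∎))
      where
      open ≤-Reasoning
      ℓ = suc q
      N = valency m * valency v
      a = paths v
      s : X → ℕ
      s β = 𝟙 (exceptional? ℓ v β)

      shuffle : ∀ s ℓ → s * (ℓ * ℓ) ≡ ℓ * (ℓ * s)
      shuffle = solve-∀

      regroup : ∀ {q N} → 0 < q → 2 * (q * N + 2 * N) + suc q * N + pred q * N ≡ 4 * (suc q * N)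
      regroup {suc q} {N} _ = lemma q N
        where
        lemma : ∀ q N → 2 * ((1 + q) * N + 2 * N) + (2 + q) * N + q * N ≡ 4 * ((2 + q) * N)
        lemma = solve-∀

      -- All exceptional β lie in a single relation w, so there are at most n_w of them.
      count : ℓ * sum s ≤ N
      count with any? (exceptional? ℓ v)
      ... | yes (β , β-exc) = ≤-trans
        (*-monoʳ-≤ ℓ (≤-trans
          (sum-mono-≤ λ β′ → 𝟙-mono (exceptional? ℓ v β′) (⟨ α , β′ ⟩∈? relation α β)
            λ β′-exc → subst (⟨ α , β′ ⟩∈_) (unique β′-exc β-exc) (∈-relation α β′))
          (≤-reflexive (valency-sum α (relation α β)))))
        (small β-exc)
      ... | no ∄exc = ≤-trans (≤-reflexive (trans
        (cong (ℓ *_) (trans (sum-cong-≗ λ β → 𝟙-no (exceptional? ℓ v β) (∄exc ∘ (β ,_)))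
                            (sum-replicate-zero ∣X∣)))
        (*-zeroʳ ℓ))) z≤n

  -- Contradiction between the two bounds

  Conclusion : ℕ → Set
  Conclusion ℓ =
    ∃ λ (u : G) → ∃ λ (v : G) → ∃ λ (w : G) → ∃ λ (w′ : G) →
      (u ≢ 𝟏) × (v ≢ 𝟏) × (w ≢ 𝟏) × (w′ ≢ 𝟏) × (u ≢ v) × (w ≢ w′) ×
      (0 < c^ w [ u *ᴳ , v ]) ×
      (c^ w [ u *ᴳ , v ] ≤ c^ w′ [ u *ᴳ , v ]) ×
      (c^ w′ [ u *ᴳ , v ] < ℓ)

  -- All quantifiers range over the finite set G. Decidability makes the proof by contradiction
  -- constructive.
  conclusion? : ∀ ℓ → Dec (Conclusion ℓ)
  conclusion? ℓ = any? λ u → any? λ v → any? λ w → any? λ w′ →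
    ¬? (u ≟ᶠ 𝟏) ×-dec ¬? (v ≟ᶠ 𝟏) ×-dec ¬? (w ≟ᶠ 𝟏) ×-dec ¬? (w′ ≟ᶠ 𝟏) ×-dec
    ¬? (u ≟ᶠ v) ×-dec ¬? (w ≟ᶠ w′) ×-dec
    (0 <? c^ w [ u *ᴳ , v ]) ×-dec
    (c^ w [ u *ᴳ , v ] ≤? c^ w′ [ u *ᴳ , v ]) ×-dec
    (c^ w′ [ u *ᴳ , v ] <? ℓ)

  -- Here q = ℓ - 1 and r = |G| - 2, named so that no truncated subtraction occurs.
  module _ {q r} (∣G∣≡2+r : ∣G∣ ≡ 2 + r) (0<q : 0 < q)
    (indist≤ : ∀ h → h ≢ 𝟏 → 2 * indistinguishing h ≤ r * q)
    (valency≤ : ∀ u v w → u ≢ 𝟏 → v ≢ 𝟏 → w ≢ 𝟏 → suc q * valency w ≤ valency u * valency v)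
    where

    conclusion-holds : Conclusion (suc q)
    conclusion-holds = decidable-stable (conclusion? (suc q)) refute
      where
      ∃m = ∃-minimizer (λ g → ¬? (g ≟ᶠ 𝟏)) valency
             (∃≢𝟏 (subst (2 ≤_) (sym ∣G∣≡2+r) (m≤m+n 2 r)))
      m = proj₁ ∃m
      m≢𝟏 = proj₁ (proj₂ ∃m)
      m-minimal = proj₂ (proj₂ ∃m)
      n = valency m
      u = m *ᴳ
      u≢𝟏 = *≢𝟏 m≢𝟏
      α = proj₁ (nonempty m)

      open Paths m α

      refute : ¬ ¬ Conclusion (suc q)
      -- Since |G| K = 2K + r q n², the upper bound gives 2T + 2K ≤ |G| K + 2nV - n r q, while the
      -- lower bounds sum to |G| K + 2nV < 2T + 2K. For r = 0 the contradiction rests on this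
      -- strictness. The term n r q is added throughout in place of subtracting it.
      refute none = <-irrefl refl (begin-strict
        ∣G∣ * K + n * (2 * V) + n * (r * q)             ≡⟨ cong (_+ n * (r * q)) sum-lhs ⟨
        sum lhs + n * (r * q)                           <⟨ +-monoˡ-< (n * (r * q)) (sum-mono-< lower u lower-strict) ⟩
        sum rhs + n * (r * q)                           ≡⟨ cong (_+ n * (r * q)) sum-rhs ⟩
        2 * T + K + K + n * (r * q)                     ≡⟨ lemma₁ T K (n * (r * q)) ⟩
        2 * T + n * (r * q) + 2 * K                     ≤⟨ +-monoˡ-≤ (2 * K) (sum-paths²-upper indist≤) ⟩
        n * n * (r * q) + n * (2 * V) + 2 * K           ≤⟨ m≤m+n _ (n * (r * q)) ⟩
        n * n * (r * q) + n * (2 * V) + 2 * K + n * (r * q) ≡⟨ lemma₂ n r q V ⟩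
        (2 + r) * K + n * (2 * V) + n * (r * q)         ≡⟨ cong (λ k → k * K + n * (2 * V) + n * (r * q)) ∣G∣≡2+r ⟨
        ∣G∣ * K + n * (2 * V) + n * (r * q)             ∎)
        where
        open ≤-Reasoning
        K = q * (n * n)
        V = ∑[ g < ∣G∣ ] valency g
        T = ∑[ v < ∣G∣ ] sum-paths² v

        -- For v = 1 and v = u the lower bound with K can fail; adding K there
        -- makes the bound uniform in v, and costs 2K in the sum over G.
        lhs rhs : G → ℕ
        lhs v = K + 2 * (n * valency v)
        rhs v = 2 * sum-paths² v + 𝟙 (𝟏 ≟ᶠ v) * K + 𝟙 (u ≟ᶠ v) * K

        lemma₁ : ∀ T K x → 2 * T + K + K + x ≡ 2 * T + x + 2 * K
        lemma₁ = solve-∀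

        lemma₂ : ∀ n r q V → n * n * (r * q) + n * (2 * V) + 2 * (q * (n * n)) + n * (r * q) ≡
                 (2 + r) * (q * (n * n)) + n * (2 * V) + n * (r * q)
        lemma₂ = solve-∀

        sum-lhs : sum lhs ≡ ∣G∣ * K + n * (2 * V)
        sum-lhs = trans (∑-distrib-+ (λ _ → K) (λ v → 2 * (n * valency v)))
          (cong₂ _+_ (sum-const ∣G∣ K) (trans
            (sum-cong-≗ λ v → swap n (valency v))
            (trans (sym (*-distribˡ-sum n (λ v → 2 * valency v)))
              (cong (n *_) (sym (*-distribˡ-sum 2 valency))))))
          where
          swap : ∀ n x → 2 * (n * x) ≡ n * (2 * x)
          swap = solve-∀

        sum-rhs : sum rhs ≡ 2 * T + K + K
        sum-rhs = trans (∑-distrib-+ (λ v → 2 * sum-paths² v + 𝟙 (𝟏 ≟ᶠ v) * K) _)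
          (cong₂ _+_ (trans (∑-distrib-+ (λ v → 2 * sum-paths² v) _)
            (cong₂ _+_ (sym (*-distribˡ-sum 2 sum-paths²)) (sum-𝟙-≟ 𝟏 (λ _ → K))))
            (sum-𝟙-≟ u (λ _ → K)))

        -- Taking u = v = w = m gives ℓ n ≤ n², so n ≥ ℓ ≥ 2.
        n≥2 : 2 ≤ n
        n≥2 = ≤-trans (s≤s 0<q) (*-cancelʳ-≤ (suc q) n n {{>-nonZero (valency-pos m)}}
          (valency≤ m m m m≢𝟏 m≢𝟏 m≢𝟏))

        -- Two different such relations, ordered by their intersection numbers, would be the w and
        -- w′ assumed not to exist.
        unique : ∀ {v} → u ≢ v → v ≢ 𝟏 → ∀ {w w′} → w ≢ 𝟏 → w′ ≢ 𝟏 →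
                 0 < c^ w [ u *ᴳ , v ] → c^ w [ u *ᴳ , v ] < suc q →
                 0 < c^ w′ [ u *ᴳ , v ] → c^ w′ [ u *ᴳ , v ] < suc q → w ≡ w′
        unique {v} u≢v v≢𝟏 {w} {w′} w≢𝟏 w′≢𝟏 0<w w<ℓ 0<w′ w′<ℓ = decidable-stable (w ≟ᶠ w′) λ w≢w′ →
          case (≤-total (c^ w [ u *ᴳ , v ]) (c^ w′ [ u *ᴳ , v ])) of λ where
            (inj₁ w≤w′) → none (u , v , w , w′ , u≢𝟏 , v≢𝟏 , w≢𝟏 , w′≢𝟏 , u≢v , w≢w′ , 0<w , w≤w′ , w′<ℓ)
            (inj₂ w′≤w) → none (u , v , w′ , w , u≢𝟏 , v≢𝟏 , w′≢𝟏 , w≢𝟏 , u≢v , w≢w′ ∘ sym , 0<w′ , w′≤w , w<ℓ)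

        -- a path from α back to itself would force v = m*
        paths⇒≢𝟏 : ∀ {v β} → u ≢ v → 0 < paths v β → relation α β ≢ 𝟏
        paths⇒≢𝟏 {v} {β} u≢v 0<paths αβ∈𝟏
          with refl ← to (𝟏-spec α β) (subst (⟨ α , β ⟩∈_) αβ∈𝟏 (∈-relation α β)) =
          <⇒≢ 0<paths (sym (trans (sum-cong-≗ no-path) (sum-replicate-zero ∣X∣)))
          where
          no-path : ∀ γ → e α γ m * e γ α v ≡ 0
          no-path γ = trans (sym (𝟙-× (⟨ α , γ ⟩∈? m) (⟨ γ , α ⟩∈? v)))
            (𝟙-no (⟨ α , γ ⟩∈? m ×-dec ⟨ γ , α ⟩∈? v)
              λ (m∋ , v∋) → u≢v (relation-unique (from (*-spec m α γ) m∋) v∋))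

        trivial-lower : ∀ v → 2 * (n * valency v) ≤ 2 * sum-paths² v
        trivial-lower v = *-monoʳ-≤ 2 (≤-trans (≤-reflexive (sym (sum-paths v)))
          (sum-mono-≤ λ β → m≤m² (paths v β)))

        lower : ∀ v → lhs v ≤ rhs v
        lower v with 𝟏 ≟ᶠ v | u ≟ᶠ v
        ... | yes _  | d = begin
          K + 2 * (n * valency v)                  ≡⟨ +-comm K _ ⟩
          2 * (n * valency v) + K                  ≤⟨ +-monoˡ-≤ K (trivial-lower v) ⟩
          2 * sum-paths² v + K                     ≡⟨ cong (2 * sum-paths² v +_) (+-identityʳ K) ⟨
          2 * sum-paths² v + 1 * K                 ≤⟨ m≤m+n _ _ ⟩
          2 * sum-paths² v + 1 * K + 𝟙 d * K       ∎
        ... | no _ | yes _ = begin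
          K + 2 * (n * valency v)                  ≡⟨ +-comm K _ ⟩
          2 * (n * valency v) + K                  ≤⟨ +-monoˡ-≤ K (trivial-lower v) ⟩
          2 * sum-paths² v + K                     ≡⟨ cong₂ _+_ (+-identityʳ (2 * sum-paths² v)) (+-identityʳ K) ⟨
          2 * sum-paths² v + 0 + 1 * K             ∎
        ... | no 𝟏≢v | no u≢v = begin
          -- Minimality of n = n_m gives n ≤ n_v, which replaces q n n_v by a constant K independent
          -- of v.
          q * (n * n) + 2 * (n * valency v)            ≤⟨ +-monoˡ-≤ _ (*-monoʳ-≤ q (*-monoʳ-≤ n (m-minimal v v≢𝟏))) ⟩
          q * (n * valency v) + 2 * (n * valency v)    ≤⟨ sum-paths²-lower 0<q exceptional-unique exceptional-small ⟩
          2 * sum-paths² v                             ≡⟨ trans (+-identityʳ _) (+-identityʳ _) ⟨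
          2 * sum-paths² v + 0 + 0                     ∎
          where
          v≢𝟏 = 𝟏≢v ∘ sym
          on-c : ∀ {β} (P : ℕ → Set) → P (paths v β) → P (c^ relation α β [ u *ᴳ , v ])
          on-c {β} P = subst P (sym (c≡paths v (∈-relation α β)))
          exceptional-unique : ∀ {β β′} → Exceptional (suc q) v β → Exceptional (suc q) v β′ →
                               relation α β ≡ relation α β′
          exceptional-unique (0<β , β<ℓ) (0<β′ , β′<ℓ) = unique u≢v v≢𝟏
            (paths⇒≢𝟏 u≢v 0<β) (paths⇒≢𝟏 u≢v 0<β′)
            (on-c (0 <_) 0<β) (on-c (_< suc q) β<ℓ) (on-c (0 <_) 0<β′) (on-c (_< suc q) β′<ℓ)
          exceptional-small : ∀ {β} → Exceptional (suc q) v β →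
                              suc q * valency (relation α β) ≤ n * valency v
          exceptional-small {β} (0<β , _) = valency≤ m v (relation α β) m≢𝟏 v≢𝟏 (paths⇒≢𝟏 u≢v 0<β)

        -- strict because all n ≥ 2 paths from α along m and back along m* return to α
        lower-strict : lhs u < rhs u
        lower-strict rewrite 𝟙-yes (u ≟ᶠ u) refl = begin-strict
          K + 2 * (n * valency u)                        ≡⟨ +-comm K _ ⟩
          2 * (n * valency u) + K                        ≡⟨ cong (λ s → 2 * s + K) (sum-paths u) ⟨
          2 * (∑[ β < ∣X∣ ] paths u β) + K
            <⟨ +-monoˡ-< K (*-monoʳ-< 2 (sum-mono-< (λ β → m≤m² (paths u β)) α paths<paths²)) ⟩
          2 * sum-paths² u + K                           ≡⟨ cong (2 * sum-paths² u +_) (+-identityʳ K) ⟨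
          2 * sum-paths² u + 1 * K                       ≤⟨ +-monoˡ-≤ (1 * K) (m≤m+n (2 * sum-paths² u) _) ⟩
          2 * sum-paths² u + 𝟙 (𝟏 ≟ᶠ u) * K + 1 * K      ∎
          where
          paths<paths² : paths u α < paths u α * paths u α
          paths<paths² rewrite paths-back = m<m*n n n {{>-nonZero (valency-pos m)}} n≥2

-- Translating the real hypotheses

theorem1p3 :
  (S : AssociationScheme) → let open AssociationScheme S in
  (c k ℓ : ℕ) (δ₁ δ₁′ δ₂′ : ℝ) →
  ⦃ 0<δ₁ : 0ℝ <ℝ δ₁ ⦄ → δ₁ ≤ℝ 1ℝ →
  ⦃ 0<δ₁′ : 0ℝ <ℝ δ₁′ ⦄ → δ₁′ ≤ℝ 1ℝ →
  ⦃ 0<δ₂′ : 0ℝ <ℝ δ₂′ ⦄ → δ₂′ ≤ℝ 1ℝ →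
  (1<ℓ : 1 < ℓ) →
  fromℕ ℓ <ℝ (δ₁ ^ℝ 2 /ℝ δ₁′) *ℝ fromℕ k →
  (∀ (g : G) → g ≢ 𝟏 →
    (δ₁ *ℝ fromℕ k ≤ℝ fromℕ (valency g)) ×
    (fromℕ (valency g) ≤ℝ δ₁′ *ℝ fromℕ k) ×
    (fromℕ (indistinguishing g) ≤ℝ δ₂′ *ℝ fromℕ c)) →
  (let instance 0<ℓ-1 = 0<∸1 1<ℓ in
    fromℕ 2 *ℝ (δ₁′ /ℝ δ₁) ^ℝ 3 *ℝ δ₂′ *ℝ (fromℕ c /ℝ fromℕ (ℓ ∸ 1)) +ℝ fromℕ 2
    ≤ℝ fromℕ ∣G∣) →
  ∃ λ (u : G) → ∃ λ (v : G) → ∃ λ (w : G) → ∃ λ (w′ : G) →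
    (u ≢ 𝟏) × (v ≢ 𝟏) × (w ≢ 𝟏) × (w′ ≢ 𝟏) × (u ≢ v) × (w ≢ w′) ×
    (0 < c^ w [ u *ᴳ , v ]) ×
    (c^ w [ u *ᴳ , v ] ≤ c^ w′ [ u *ᴳ , v ]) ×
    (c^ w′ [ u *ᴳ , v ] < ℓ)
theorem1p3 S c k ℓ δ₁ δ₁′ δ₂′ ⦃ 0<δ₁ ⦄ _ ⦃ 0<δ₁′ ⦄ _ ⦃ 0<δ₂′ ⦄ _ 1<ℓ ℓ< bounds large =
  subst (Conclusion S) 1+q≡ℓ
    (conclusion-holds S (sym 2+r≡∣G∣) (m<n⇒0<n∸m 1<ℓ) indist≤ valency≤)
  where
  open AssociationScheme S

  0<ℓ-1 : 0ℝ <ℝ fromℕ (ℓ ∸ 1)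
  0<ℓ-1 = 0<∸1 1<ℓ
  k≢0 : ℕ.NonZero k
  k≢0 = <ℝ*⇒nonZero {ℓ} (_/ℝ_ (δ₁ ^ℝ 2) δ₁′ ⦃ 0<δ₁′ ⦄) k ℓ<
  q : ℕ
  q = ℓ ∸ 1
  1+q≡ℓ : suc q ≡ ℓ
  1+q≡ℓ = m+[n∸m]≡n (<⇒≤ 1<ℓ)
  ρ : ℝ
  ρ = _/ℝ_ δ₁′ δ₁ ⦃ 0<δ₁ ⦄
  0≤ρ : EventuallyNonNeg ρ
  0≤ρ = /ℝ-nonNeg {δ₁′} δ₁ ⦃ 0<δ₁ ⦄ (pos⇒nonNeg {δ₁′} (<ℝ⇒pos {δ₁′} 0<δ₁′))
  0≤δ₂′ : EventuallyNonNeg δ₂′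
  0≤δ₂′ = pos⇒nonNeg {δ₂′} (<ℝ⇒pos {δ₂′} 0<δ₂′)

  ∃r : ∃ λ r → 2 + r ≡ ∣G∣
  ∃r = m≤n⇒∃[o]m+o≡n (large⇒≥2 ρ δ₂′ 0≤ρ 0≤δ₂′ c q ∣G∣ ⦃ 0<ℓ-1 ⦄ large)
  r : ℕ
  r = proj₁ ∃r
  2+r≡∣G∣ : 2 + r ≡ ∣G∣
  2+r≡∣G∣ = proj₂ ∃r

  valency≤ : ∀ u v w → u ≢ 𝟏 → v ≢ 𝟏 → w ≢ 𝟏 → suc q * valency w ≤ valency u * valency v
  valency≤ u v w u≢𝟏 v≢𝟏 w≢𝟏 = subst (λ l → l * valency w ≤ valency u * valency v) (sym 1+q≡ℓ)
    (ℕ-product-≤ δ₁ δ₁′ ⦃ 0<δ₁ ⦄ ⦃ 0<δ₁′ ⦄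
      {ℓ} {k} {valency u} {valency v} {valency w} ℓ<
      (proj₁ (bounds u u≢𝟏)) (proj₁ (bounds v v≢𝟏)) (proj₁ (proj₂ (bounds w w≢𝟏))))

  -- The valency of h lies between δ₁ k and δ₁′ k, and k > 0, so δ₁ ≤ δ₁′.
  1≤ρ : ∀ h → h ≢ 𝟏 → 1ℝ ≤ℝ ρ
  1≤ρ h h≢𝟏 = 1≤/ℝ δ₁ δ₁′ ⦃ 0<δ₁ ⦄ ⦃ 0<δ₁′ ⦄ k {{k≢0}}
    (≤ℝ-trans {δ₁ *ℝ fromℕ k} {fromℕ (valency h)} {δ₁′ *ℝ fromℕ k}
      (proj₁ (bounds h h≢𝟏)) (proj₁ (proj₂ (bounds h h≢𝟏))))

  indist≤ : ∀ h → h ≢ 𝟏 → 2 * indistinguishing h ≤ r * q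
  -- Adding 2q to both sides turns r q into |G| q, the form in which the size hypothesis applies.
  indist≤ h h≢𝟏 = +-cancelʳ-≤ (2 * q) _ _ (begin
    2 * indistinguishing h + 2 * q
      ≤⟨ large⇒2*i+2*q≤ ρ δ₂′ 0≤ρ 0≤δ₂′ c q ∣G∣ ⦃ 0<ℓ-1 ⦄ large {indistinguishing h}
           (1≤ρ h h≢𝟏) (proj₂ (proj₂ (bounds h h≢𝟏))) ⟩
    ∣G∣ * q       ≡⟨ cong (_* q) 2+r≡∣G∣ ⟨
    (2 + r) * q   ≡⟨ *-distribʳ-+ q 2 r ⟩
    2 * q + r * q ≡⟨ +-comm (2 * q) (r * q) ⟩
    r * q + 2 * q ∎)
    where open ≤-Reasoning
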